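{- Let $P_{(2,0,0)}$ be the set of all cylindric partitions with profile $c=(2,0,0)$. Then, as formal power series in $q$, $$\sum_{\Lambda\in P_{(2,0,0)}} q^{|\Lambda|}=\left(\sum_{n\ge0}\frac{q^{n^2+2n}}{(q^4;q^4)_n}\right)\frac{(-q^2;q^2)_\infty}{(q;q)_\infty}.$$
   Context: Let $r,\ell$ be positive integers and $c=(c_1,\dots,c_r)$ a composition of $\ell$ into $r$ nonnegative integer parts (zero entries allowed). A cylindric partition with profile $c$ is a tuple $\Lambda=(\lambda^{(1)},\dots,\lambda^{(r)})$ of ordinary partitions $\lambda^{(i)}=(\lambda^{(i)}_1\ge\lambda^{(i)}_2\ge\cdots)$ (parts beyond the length are taken to be $0$) such that for all $i,j$: $\lambda^{(i)}_j\ge\lambda^{(i+1)}_{j+c_{i+1}}$ for $1\le i\le r-1$, and $\lambda^{(r)}_j\ge\lambda^{(1)}_{j+c_1}$. The size $|\Lambda|$ is the sum of all parts of all $\lambda^{(i)}$; the empty cylindric partition is included with size $0$. Notation: $(a;q)_n=\prod_{k=1}^n(1-aq^{k-1})$, $(a;q)_\infty=\lim_{n\to\infty}(a;q)_n$. -}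

module Defs where

open import Data.Nat as ℕ using (ℕ; zero; suc; _∸_; _≥_; _<_; _≡ᵇ_)
open import Data.Nat.DivMod using (_mod_)
open import Data.Integer as ℤ using (ℤ; +_; -_)
open import Data.Fin using (Fin; toℕ)
open import Data.List using (List; []; _∷_; length)
open import Data.Nat.ListAction using (sum)
open import Data.List.Relation.Unary.All using (All)
open import Data.List.Relation.Unary.Linked using (Linked)
open import Data.List.Relation.Unary.Unique.Propositional using (Unique)
open import Data.List.Membership.Propositional using (_∈_)
open import Data.Vec using (Vec; lookup; toList; map)
open import Data.Product using (Σ; _×_)
open import Data.Bool using (if_then_else_)
open import Function.Bundles using (_⇔_)
open import Relation.Binary.PropositionalEquality using (_≡_)

-- An ordinary partition is a list of positive parts in weakly
-- decreasing order (each partition has a unique such representation).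
IsPartition : List ℕ → Set
IsPartition xs = Linked _≥_ xs × All (λ x → 0 < x) xs

part : List ℕ → ℕ → ℕ
part []       _       = 0
part (x ∷ xs) zero    = x
part (x ∷ xs) (suc j) = part xs j

nextIdx : ∀ {n} → Fin (suc n) → Fin (suc n)
nextIdx {n} i = suc (toℕ i) mod suc n

-- Cylindric partition with profile c = (c_1,…,c_r) (r = suc n), indices
-- 0-based: component i of Λ is λ^(i+1). Condition: for every i (cyclically)
-- and every j, λ^(i)_j ≥ λ^(i+1)_{j + c_{i+1}}.
IsCylindricPartition : ∀ {n} → Vec ℕ (suc n) → Vec (List ℕ) (suc n) → Set
IsCylindricPartition {n} c Λ =
  ((i : Fin (suc n)) → IsPartition (lookup Λ i)) ×
  ((i : Fin (suc n)) (j : ℕ) →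
     part (lookup Λ i) j ≥ part (lookup Λ (nextIdx i)) (j ℕ.+ lookup c (nextIdx i)))

cpSize : ∀ {r} → Vec (List ℕ) r → ℕ
cpSize Λ = sum (toList (map sum Λ))

HasCount : {A : Set} → (A → Set) → ℕ → Set
HasCount {A} P k = Σ (List A) λ L → Unique L × length L ≡ k × ((x : A) → (x ∈ L) ⇔ P x)

Series : Set
Series = ℕ → ℤ

sumTo : ℕ → (ℕ → ℤ) → ℤ
sumTo zero    f = + 0
sumTo (suc n) f = sumTo n f ℤ.+ f n

oneₛ : Series
oneₛ n = if n ≡ᵇ 0 then + 1 else + 0

qpow : ℕ → Series
qpow m n = if n ≡ᵇ m then + 1 else + 0

_+ₛ_ : Series → Series → Series
(f +ₛ g) n = f n ℤ.+ g n

negₛ : Series → Series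
negₛ f n = - f n

_-ₛ_ : Series → Series → Series
f -ₛ g = f +ₛ negₛ g

_*ₛ_ : Series → Series → Series
(f *ₛ g) n = sumTo (suc n) (λ k → f k ℤ.* g (n ∸ k))

infixl 7 _*ₛ_
infixl 6 _+ₛ_ _-ₛ_

_^ₛ_ : Series → ℕ → Series
f ^ₛ zero  = oneₛ
f ^ₛ suc j = f *ₛ (f ^ₛ j)

-- multiplicative inverse of a series with constant term 1:
-- 1/f = Σ_{j≥0} (1 - f)^j ; since 1 - f has zero constant term,
-- the coefficient of q^n only involves j ≤ n.
invₛ : Series → Series
invₛ f n = sumTo (suc n) (λ j → ((oneₛ -ₛ f) ^ₛ j) n)

finProd : ℕ → (ℕ → Series) → Series
finProd zero    F = oneₛ
finProd (suc m) F = finProd m F *ₛ F m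

-- infinite product ∏_{k≥0} F k, for factors with F k ≡ 1 mod q^{k+1}
-- (coefficient of q^n is determined by the first n+1 factors)
infProd : (ℕ → Series) → Series
infProd F n = finProd (suc n) F n

-- infinite sum Σ_{k≥0} F k, for terms with F k ≡ 0 mod q^k
infSum : (ℕ → Series) → Series
infSum F n = sumTo (suc n) (λ k → F k n)

poch : Series → Series → ℕ → Series
poch a p n = finProd n (λ k → oneₛ -ₛ a *ₛ (p ^ₛ k))

-- (a;p)_∞, for a, p with zero constant term
pochInf : Series → Series → Series
pochInf a p = infProd (λ k → oneₛ -ₛ a *ₛ (p ^ₛ k))

rhs : Series
rhs = infSum (λ n → qpow (n ℕ.* n ℕ.+ 2 ℕ.* n) *ₛ invₛ (poch (qpow 4) (qpow 4) n))
      *ₛ pochInf (negₛ (qpow 2)) (qpow 2)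
      *ₛ invₛ (pochInf (qpow 1) (qpow 1))

{-# OPTIONS --safe #-}
module Submission where

-- Cut a cylindric partition of profile (2,0,0) horizontally: its h-th layer is the triple
-- (#{j : λ⁽¹⁾_j ≥ h}, #{j : λ⁽²⁾_j ≥ h}, #{j : λ⁽³⁾_j ≥ h}), and the condition says that each
-- layer (x,y,z) satisfies z ≤ y ≤ x ≤ z+2 and that the layers decrease componentwise. There are
-- at most two such triples of each size s, A_s (s = 0 or s ≥ 2) and B_s (s ≥ 1), and they are
-- all comparable except for the pairs A_s, B_s and A_s, A_{s+1}. Hence, if a_s and b_s are the
-- generating functions of the partitions with bottom layer ≤ A_s, respectively ≤ B_s,
--   (1-q^s) a_s = b_{s-1},   (1-q^s) b_s = b_{s-1} + q^{s-1} a_{s-1}   (s ≥ 2, a_1 = 0),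
-- so that D_s = (q;q)_{s+1} b_{s+1} satisfies D_s = D_{s-1} + q^s D_{s-2}, D_0 = D_1 = 1.
--
-- On the other side put
--   E_i = Σ_n q^{n²+(2i+2)n} (-q^{2(i+n)+2};q²)_∞ / (q²;q²)_n,
--   O_i = Σ_n q^{n²+(2i+2)n} (-q^{2(i+n)+4};q²)_∞ / (q²;q²)_n.
-- Then E_i = O_i + q^{2i+2} E_{i+1} and O_i = E_{i+1} + q^{2i+3} O_{i+1}, so by induction
-- E_0 = D_{2i+1} O_i + q^{2i+2} D_{2i} E_{i+1}, which tends to lim D_s. Finally
-- E_0 = (-q²;q²)_∞ Σ_n q^{n²+2n} / (q⁴;q⁴)_n.

open import Defs
open import Data.Nat using (ℕ)
open import Data.Integer using (+_)
open import Data.List using (List)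
open import Data.Vec using (Vec; []; _∷_)
open import Data.Product using (Σ; _×_)
open import Relation.Binary.PropositionalEquality using (_≡_)

open import Algebra.Bundles using (CommutativeRing)
import Algebra.Properties.Ring as RingProperties
import Algebra.Solver.Ring.NaturalCoefficients.Default as SemiringSolver
open import Data.Empty using (⊥-elim)
open import Data.Fin using (zero; suc)
open import Data.Integer as ℤ using (ℤ)
import Data.Integer.Properties as ℤₚ
import Data.Integer.Tactic.RingSolver as ℤ-RingSolver
open import Data.List using ([]; _∷_; _++_; length; map)
open import Data.List.Membership.Propositional using (_∈_)
open import Data.List.Membership.Propositional.Properties using (∈-map⁺; ∈-map⁻; ∈-++⁺ˡ; ∈-++⁺ʳ; ∈-++⁻)
open import Data.List.Properties using (length-map; length-++)
open import Data.List.Relation.Unary.All as All using (All; []; _∷_)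
import Data.List.Relation.Unary.All.Properties as Allₚ
open import Data.List.Relation.Unary.AllPairs using ([]; _∷_)
open import Data.List.Relation.Unary.Any using (here; there)
open import Data.List.Relation.Unary.Linked using (Linked; []; [-]; _∷_)
open import Data.List.Relation.Unary.Unique.Propositional using (Unique)
import Data.List.Relation.Unary.Unique.Propositional.Properties as Uniqueₚ
open import Data.Nat as ℕ using (zero; suc; _∸_; _≤_; _≥_; _<_; z≤n; s≤s)
open import Data.Nat.Induction using (<-rec)
open import Data.Nat.ListAction using (sum)
import Data.Nat.Properties as ℕₚ
open import Data.Nat.Tactic.RingSolver using (solve-∀)
open import Data.Product using (_,_; proj₁; proj₂)
open import Data.Sum as Sum using (_⊎_; inj₁; inj₂; [_,_])
open import Function using (_∘_)
open import Function.Bundles using (_⇔_; mk⇔; Equivalence)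
open import Level using (0ℓ)
open import Relation.Nullary using (¬_; yes; no)
open import Relation.Binary.PropositionalEquality using (refl; sym; trans; cong; cong₂; subst; module ≡-Reasoning)
import Relation.Binary.Reasoning.Setoid as SetoidReasoning

-- Power series

sumTo-cong : ∀ n {f g} → (∀ k → k < n → f k ≡ g k) → sumTo n f ≡ sumTo n g
sumTo-cong zero    h = refl
sumTo-cong (suc n) h =
  cong₂ ℤ._+_ (sumTo-cong n (λ k k<n → h k (ℕₚ.m<n⇒m<1+n k<n))) (h n ℕₚ.≤-refl)

sumTo-suc : ∀ n f → sumTo (suc n) f ≡ f 0 ℤ.+ sumTo n (f ∘ suc)
sumTo-suc zero    f = ℤₚ.+-comm (+ 0) (f 0)
sumTo-suc (suc n) f = trans (cong (ℤ._+ f (suc n)) (sumTo-suc n f)) (ℤₚ.+-assoc (f 0) _ _)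

sumTo-+ : ∀ n f g → sumTo n (λ k → f k ℤ.+ g k) ≡ sumTo n f ℤ.+ sumTo n g
sumTo-+ zero    f g = refl
sumTo-+ (suc n) f g = trans (cong (ℤ._+ (f n ℤ.+ g n)) (sumTo-+ n f g))
  (interchange (sumTo n f) (sumTo n g) (f n) (g n))
  where
  interchange : ∀ a b c d → (a ℤ.+ b) ℤ.+ (c ℤ.+ d) ≡ (a ℤ.+ c) ℤ.+ (b ℤ.+ d)
  interchange = ℤ-RingSolver.solve-∀

sumTo-*ˡ : ∀ n c f → sumTo n (λ k → c ℤ.* f k) ≡ c ℤ.* sumTo n f
sumTo-*ˡ zero    c f = sym (ℤₚ.*-zeroʳ c)
sumTo-*ˡ (suc n) c f =
  trans (cong (ℤ._+ c ℤ.* f n) (sumTo-*ˡ n c f)) (sym (ℤₚ.*-distribˡ-+ c _ _))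

sumTo-0 : ∀ n → sumTo n (λ _ → + 0) ≡ + 0
sumTo-0 zero    = refl
sumTo-0 (suc n) = trans (ℤₚ.+-identityʳ _) (sumTo-0 n)

zeroₛ : Series
zeroₛ _ = + 0

tailₛ : Series → Series
tailₛ f = f ∘ suc

-- With `*ₛ-sucʳ` this peels the constant coefficient off one factor, so the ring laws follow by
-- induction on the coefficient index and no double sum has to be reindexed.
*ₛ-suc : ∀ f g n → (f *ₛ g) (suc n) ≡ f 0 ℤ.* g (suc n) ℤ.+ (tailₛ f *ₛ g) n
*ₛ-suc f g n = sumTo-suc (suc n) (λ k → f k ℤ.* g (suc n ∸ k))

*ₛ-sucʳ : ∀ f g n → (f *ₛ g) (suc n) ≡ (f *ₛ tailₛ g) n ℤ.+ f (suc n) ℤ.* g 0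
*ₛ-sucʳ f g n = cong₂ ℤ._+_
  (sumTo-cong (suc n) λ { k (s≤s k≤n) → cong (λ m → f k ℤ.* g m) (ℕₚ.+-∸-assoc 1 k≤n) })
  (cong (λ m → f (suc n) ℤ.* g m) (ℕₚ.n∸n≡0 n))

*ₛ-comm : ∀ f g n → (f *ₛ g) n ≡ (g *ₛ f) n
*ₛ-comm f g zero    = cong (λ x → + 0 ℤ.+ x) (ℤₚ.*-comm (f 0) (g 0))
*ₛ-comm f g (suc n) = begin
  (f *ₛ g) (suc n)                            ≡⟨ *ₛ-suc f g n ⟩
  f 0 ℤ.* g (suc n) ℤ.+ (tailₛ f *ₛ g) n      ≡⟨ ℤₚ.+-comm (f 0 ℤ.* g (suc n)) _ ⟩
  (tailₛ f *ₛ g) n ℤ.+ f 0 ℤ.* g (suc n)      ≡⟨ cong₂ ℤ._+_ (*ₛ-comm (tailₛ f) g n) (ℤₚ.*-comm (f 0) _) ⟩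
  (g *ₛ tailₛ f) n ℤ.+ g (suc n) ℤ.* f 0      ≡⟨ sym (*ₛ-sucʳ g f n) ⟩
  (g *ₛ f) (suc n)                            ∎
  where open ≡-Reasoning

*ₛ-distribʳ : ∀ h f g n → ((f +ₛ g) *ₛ h) n ≡ (f *ₛ h) n ℤ.+ (g *ₛ h) n
*ₛ-distribʳ h f g n = trans
  (sumTo-cong (suc n) λ k _ → ℤₚ.*-distribʳ-+ (h (n ∸ k)) (f k) (g k))
  (sumTo-+ (suc n) _ _)

*ₛ-scaleˡ : ∀ c f g n → ((λ k → c ℤ.* f k) *ₛ g) n ≡ c ℤ.* (f *ₛ g) n
*ₛ-scaleˡ c f g n = trans
  (sumTo-cong (suc n) λ k _ → ℤₚ.*-assoc c (f k) (g (n ∸ k)))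
  (sumTo-*ˡ (suc n) c _)

*ₛ-zeroˡ : ∀ f n → (zeroₛ *ₛ f) n ≡ + 0
*ₛ-zeroˡ f n = sumTo-0 (suc n)

*ₛ-identityˡ : ∀ f n → (oneₛ *ₛ f) n ≡ f n
*ₛ-identityˡ f zero    = trans (ℤₚ.+-identityˡ _) (ℤₚ.*-identityˡ (f 0))
*ₛ-identityˡ f (suc n) = begin
  (oneₛ *ₛ f) (suc n)                          ≡⟨ *ₛ-suc oneₛ f n ⟩
  + 1 ℤ.* f (suc n) ℤ.+ (zeroₛ *ₛ f) n         ≡⟨ cong₂ ℤ._+_ (ℤₚ.*-identityˡ (f (suc n))) (*ₛ-zeroˡ f n) ⟩
  f (suc n) ℤ.+ + 0                            ≡⟨ ℤₚ.+-identityʳ _ ⟩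
  f (suc n)                                    ∎
  where open ≡-Reasoning

*ₛ-assoc : ∀ f g h n → ((f *ₛ g) *ₛ h) n ≡ (f *ₛ (g *ₛ h)) n
*ₛ-assoc f g h zero    = head (f 0) (g 0) (h 0)
  where
  head : ∀ a b c → + 0 ℤ.+ (+ 0 ℤ.+ a ℤ.* b) ℤ.* c ≡ + 0 ℤ.+ a ℤ.* (+ 0 ℤ.+ b ℤ.* c)
  head = ℤ-RingSolver.solve-∀
*ₛ-assoc f g h (suc n) = begin
  ((f *ₛ g) *ₛ h) (suc n)
    ≡⟨ *ₛ-suc (f *ₛ g) h n ⟩
  (f *ₛ g) 0 ℤ.* h (suc n) ℤ.+ (tailₛ (f *ₛ g) *ₛ h) n
    ≡⟨ cong (λ x → (f *ₛ g) 0 ℤ.* h (suc n) ℤ.+ x) tail-product ⟩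
  (f *ₛ g) 0 ℤ.* h (suc n) ℤ.+ (f 0 ℤ.* (tailₛ g *ₛ h) n ℤ.+ (tailₛ f *ₛ (g *ₛ h)) n)
    ≡⟨ regroup (f 0) (g 0) (h (suc n)) _ _ ⟩
  f 0 ℤ.* (g 0 ℤ.* h (suc n) ℤ.+ (tailₛ g *ₛ h) n) ℤ.+ (tailₛ f *ₛ (g *ₛ h)) n
    ≡⟨ cong (λ x → f 0 ℤ.* x ℤ.+ (tailₛ f *ₛ (g *ₛ h)) n) (sym (*ₛ-suc g h n)) ⟩
  f 0 ℤ.* (g *ₛ h) (suc n) ℤ.+ (tailₛ f *ₛ (g *ₛ h)) n
    ≡⟨ sym (*ₛ-suc f (g *ₛ h) n) ⟩
  (f *ₛ (g *ₛ h)) (suc n) ∎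
  where
  open ≡-Reasoning
  regroup : ∀ a b c d e →
    (+ 0 ℤ.+ a ℤ.* b) ℤ.* c ℤ.+ (a ℤ.* d ℤ.+ e) ≡ a ℤ.* (b ℤ.* c ℤ.+ d) ℤ.+ e
  regroup = ℤ-RingSolver.solve-∀
  -- The tail of f g is f₀ (tail g) + (tail f) g. Only the second summand needs the induction
  -- hypothesis, at the smaller index `n` with `tailₛ f` in place of `f`.
  tail-product : (tailₛ (f *ₛ g) *ₛ h) n ≡ f 0 ℤ.* (tailₛ g *ₛ h) n ℤ.+ (tailₛ f *ₛ (g *ₛ h)) n
  tail-product = begin
    (tailₛ (f *ₛ g) *ₛ h) n
      ≡⟨ sumTo-cong (suc n) (λ k _ → cong (ℤ._* h (n ∸ k)) (*ₛ-suc f g k)) ⟩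
    (((λ k → f 0 ℤ.* tailₛ g k) +ₛ (tailₛ f *ₛ g)) *ₛ h) n
      ≡⟨ *ₛ-distribʳ h (λ k → f 0 ℤ.* tailₛ g k) (tailₛ f *ₛ g) n ⟩
    ((λ k → f 0 ℤ.* tailₛ g k) *ₛ h) n ℤ.+ ((tailₛ f *ₛ g) *ₛ h) n
      ≡⟨ cong₂ ℤ._+_ (*ₛ-scaleˡ (f 0) (tailₛ g) h n) (*ₛ-assoc (tailₛ f) g h n) ⟩
    f 0 ℤ.* (tailₛ g *ₛ h) n ℤ.+ (tailₛ f *ₛ (g *ₛ h)) n ∎

-- ℤ[[q]]/(q^{N+1}), with the quotient taken in the equality.
truncatedRing : ℕ → CommutativeRing 0ℓ 0ℓ
truncatedRing N = record
  { Carrier = Series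
  ; _≈_ = λ f g → ∀ n → n ≤ N → f n ≡ g n
  ; _+_ = _+ₛ_
  ; _*_ = _*ₛ_
  ; -_ = negₛ
  ; 0# = zeroₛ
  ; 1# = oneₛ
  ; isCommutativeRing = record
    { isRing = record
      { +-isAbelianGroup = record
        { isGroup = record
          { isMonoid = record
            { isSemigroup = record
              { isMagma = record
                { isEquivalence = record
                  { refl = λ _ _ → refl
                  ; sym = λ p n n≤N → sym (p n n≤N)
                  ; trans = λ p r n n≤N → trans (p n n≤N) (r n n≤N)
                  }
                ; ∙-cong = λ p r n n≤N → cong₂ ℤ._+_ (p n n≤N) (r n n≤N)
                }
              ; assoc = λ f g h n _ → ℤₚ.+-assoc (f n) (g n) (h n)
              }
            ; identity = (λ f n _ → ℤₚ.+-identityˡ (f n)) , (λ f n _ → ℤₚ.+-identityʳ (f n))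
            }
          ; inverse = (λ f n _ → ℤₚ.+-inverseˡ (f n)) , (λ f n _ → ℤₚ.+-inverseʳ (f n))
          ; ⁻¹-cong = λ p n n≤N → cong ℤ.-_ (p n n≤N)
          }
        ; comm = λ f g n _ → ℤₚ.+-comm (f n) (g n)
        }
      ; *-cong = λ p r n n≤N → sumTo-cong (suc n) λ { k (s≤s k≤n) → cong₂ ℤ._*_
          (p k (ℕₚ.≤-trans k≤n n≤N)) (r (n ∸ k) (ℕₚ.≤-trans (ℕₚ.m∸n≤m n k) n≤N)) }
      ; *-assoc = λ f g h n _ → *ₛ-assoc f g h n
      ; *-identity = (λ f n _ → *ₛ-identityˡ f n)
                   , (λ f n _ → trans (*ₛ-comm f oneₛ n) (*ₛ-identityˡ f n))
      ; distrib = (λ f g h n _ → trans (*ₛ-comm f (g +ₛ h) n) (trans (*ₛ-distribʳ f g h n)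
                    (cong₂ ℤ._+_ (*ₛ-comm g f n) (*ₛ-comm h f n))))
                , (λ f g h n _ → *ₛ-distribʳ f g h n)
      }
    ; *-comm = λ f g n _ → *ₛ-comm f g n
    }
  }

qpow-*-+ : ∀ m f n → (qpow m *ₛ f) (m ℕ.+ n) ≡ f n
qpow-*-+ zero    f n = *ₛ-identityˡ f n
qpow-*-+ (suc m) f n = trans (*ₛ-suc (qpow (suc m)) f (m ℕ.+ n))
  (trans (ℤₚ.+-identityˡ _) (qpow-*-+ m f n))

qpow-*-< : ∀ m f n → n < m → (qpow m *ₛ f) n ≡ + 0
qpow-*-< (suc m) f zero    _         = refl
qpow-*-< (suc m) f (suc n) (s≤s n<m) = trans (*ₛ-suc (qpow (suc m)) f n)
  (trans (ℤₚ.+-identityˡ _) (qpow-*-< m f n n<m))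

qpow-+ : ∀ m n k → (qpow m *ₛ qpow n) k ≡ qpow (m ℕ.+ n) k
qpow-+ zero    n k       = *ₛ-identityˡ (qpow n) k
qpow-+ (suc m) n zero    = refl
qpow-+ (suc m) n (suc k) = trans (*ₛ-suc (qpow (suc m)) (qpow n) k)
  (trans (ℤₚ.+-identityˡ _) (qpow-+ m n k))

qpow-< : ∀ m n → n < m → qpow m n ≡ + 0
qpow-< (suc m) zero    _         = refl
qpow-< (suc m) (suc n) (s≤s n<m) = qpow-< m n n<m

sumTo-stable : ∀ {m n} f → m ℕ.≤′ n → (∀ k → m ≤ k → f k ≡ + 0) → sumTo n f ≡ sumTo m f
sumTo-stable f (ℕ.≤′-reflexive refl) f≡0 = refl
sumTo-stable f (ℕ.≤′-step m≤n)       f≡0 =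
  trans (cong₂ ℤ._+_ (sumTo-stable f m≤n f≡0) (f≡0 _ (ℕₚ.≤′⇒≤ m≤n))) (ℤₚ.+-identityʳ _)

sumₛ : ℕ → (ℕ → Series) → Series
sumₛ m F n = sumTo m (λ k → F k n)

-- Each multiplication by a series without constant term raises the order by at least one. Hence the
-- powers beyond the n-th do not reach the coefficient of qⁿ in `invₛ`.
^ₛ-< : ∀ u → u 0 ≡ + 0 → ∀ j n → n < j → (u ^ₛ j) n ≡ + 0
^ₛ-< u u₀ (suc j) zero    _         =
  trans (ℤₚ.+-identityˡ _) (cong (ℤ._* (u ^ₛ j) 0) u₀)
^ₛ-< u u₀ (suc j) (suc n) (s≤s n<j) = begin
  (u *ₛ (u ^ₛ j)) (suc n)
    ≡⟨ *ₛ-suc u (u ^ₛ j) n ⟩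
  u 0 ℤ.* (u ^ₛ j) (suc n) ℤ.+ (tailₛ u *ₛ (u ^ₛ j)) n
    ≡⟨ cong₂ ℤ._+_ (cong (ℤ._* (u ^ₛ j) (suc n)) u₀)
         (sumTo-cong (suc n) λ k _ → trans
           (cong (u (suc k) ℤ.*_) (^ₛ-< u u₀ j (n ∸ k) (ℕₚ.≤-<-trans (ℕₚ.m∸n≤m n k) n<j)))
           (ℤₚ.*-zeroʳ (u (suc k)))) ⟩
  + 0 ℤ.+ sumTo (suc n) (λ _ → + 0)
    ≡⟨ trans (ℤₚ.+-identityˡ _) (sumTo-0 (suc n)) ⟩
  + 0 ∎
  where open ≡-Reasoning

-- Identities in a commutative ring

module RingIdentities (R : CommutativeRing 0ℓ 0ℓ) where
  open CommutativeRing R renaming (refl to ≈-refl; sym to ≈-sym; trans to ≈-trans)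
  open RingProperties ring using (-‿distribˡ-*; -‿involutive)
  open SemiringSolver commutativeSemiring
  open SetoidReasoning setoid

  module _
    (f : Carrier) (uᵏ s : ℕ → Carrier)
    (uᵏ-0 : uᵏ 0 ≈ 1#) (uᵏ-suc : ∀ k → uᵏ (suc k) ≈ (1# + - f) * uᵏ k)
    (s-0 : s 0 ≈ 0#) (s-suc : ∀ k → s (suc k) ≈ s k + uᵏ k)
    where

    u : Carrier
    u = 1# + - f

    f+u≈1 : f + u ≈ 1#
    f+u≈1 = begin
      f + (1# + - f)   ≈⟨ +-congˡ (+-comm 1# (- f)) ⟩
      f + (- f + 1#)   ≈⟨ ≈-sym (+-assoc f (- f) 1#) ⟩
      f + - f + 1#     ≈⟨ +-congʳ (-‿inverseʳ f) ⟩
      0# + 1#          ≈⟨ +-identityˡ 1# ⟩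
      1# ∎

    -- The sum telescopes: the summand u^k added to `s` contributes f u^k, which together with
    -- u^{k+1} = u u^k gives (f + u) u^k = u^k. Once a power of u vanishes, `s` is the inverse of f.
    geometric-sum : ∀ k → f * s k + uᵏ k ≈ 1#
    geometric-sum zero    = begin
      f * s 0 + uᵏ 0   ≈⟨ +-cong (≈-trans (*-congˡ s-0) (zeroʳ f)) uᵏ-0 ⟩
      0# + 1#          ≈⟨ +-identityˡ 1# ⟩
      1# ∎
    geometric-sum (suc k) = begin
      f * s (suc k) + uᵏ (suc k)           ≈⟨ +-cong (*-congˡ (s-suc k)) (uᵏ-suc k) ⟩
      f * (s k + uᵏ k) + u * uᵏ k          ≈⟨ +-congʳ (distribˡ f _ _) ⟩
      f * s k + f * uᵏ k + u * uᵏ k        ≈⟨ +-assoc _ _ _ ⟩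
      f * s k + (f * uᵏ k + u * uᵏ k)      ≈⟨ +-congˡ (≈-sym (distribʳ _ f u)) ⟩
      f * s k + (f + u) * uᵏ k             ≈⟨ +-congˡ (≈-trans (*-congʳ f+u≈1) (*-identityˡ _)) ⟩
      f * s k + uᵏ k                       ≈⟨ geometric-sum k ⟩
      1# ∎

    geometric-inverse : ∀ {k x} → uᵏ k ≈ 0# → x ≈ s k → f * x ≈ 1#
    geometric-inverse {k} {x} uᵏ≈0 x≈s = begin
      f * x            ≈⟨ *-congˡ x≈s ⟩
      f * s k          ≈⟨ ≈-sym (+-identityʳ _) ⟩
      f * s k + 0#     ≈⟨ +-congˡ (≈-sym uᵏ≈0) ⟩
      f * s k + uᵏ k   ≈⟨ geometric-sum k ⟩
      1# ∎

  *-quotient : ∀ {r i} → r * i ≈ 1# → ∀ g → r * (g * i) ≈ g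
  *-quotient {r} {i} ri≈1 g = begin
    r * (g * i)   ≈⟨ *-congˡ (*-comm g i) ⟩
    r * (i * g)   ≈⟨ ≈-sym (*-assoc r i g) ⟩
    r * i * g     ≈⟨ ≈-trans (*-congʳ ri≈1) (*-identityˡ g) ⟩
    g ∎

  quotient-recurrence : ∀ {x f g} → (1# + - x) * f ≈ g → f ≈ g + x * f
  quotient-recurrence {x} {f} {g} eq = ≈-sym (begin
    g + x * f                  ≈⟨ +-congʳ (≈-sym eq) ⟩
    (1# + - x) * f + x * f     ≈⟨ ≈-sym (distribʳ f _ x) ⟩
    (1# + - x + x) * f         ≈⟨ *-congʳ (≈-trans (+-assoc 1# _ x) (+-congˡ (-‿inverseˡ x))) ⟩
    (1# + 0#) * f              ≈⟨ ≈-trans (*-congʳ (+-identityʳ 1#)) (*-identityˡ f) ⟩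
    f ∎)

  1-neg : ∀ {x y z} → x * y ≈ z → 1# + - (- x * y) ≈ 1# + z
  1-neg {x} {y} eq = +-congˡ (≈-trans (-‿cong (≈-sym (-‿distribˡ-* x y))) (≈-trans (-‿involutive _) eq))

  -- The letters with ∞ are the infinite sum and products of `rhs`, those without are their finite
  -- truncations. Both w s and p b equal d, and dividing by p leaves b.
  solve-for : ∀ {s s∞ w w∞ p p∞ i b d} → s∞ ≈ s → w∞ ≈ w → p∞ ≈ p → p∞ * i ≈ 1# →
    w * s ≈ d → p * b ≈ d → s∞ * w∞ * i ≈ b
  solve-for {s} {s∞} {w} {w∞} {p} {p∞} {i} {b} {d} s≈ w≈ p≈ inv ws≈d pb≈d = begin
    s∞ * w∞ * i     ≈⟨ *-congʳ (*-cong s≈ w≈) ⟩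
    s * w * i       ≈⟨ *-congʳ (≈-trans (*-comm s w) ws≈d) ⟩
    d * i           ≈⟨ *-congʳ (≈-sym pb≈d) ⟩
    p * b * i       ≈⟨ *-congʳ (≈-trans (*-congʳ (≈-sym p≈)) (*-comm p∞ b)) ⟩
    b * p∞ * i      ≈⟨ ≈-trans (*-assoc b p∞ i) (*-congˡ inv) ⟩
    b * 1#          ≈⟨ *-identityʳ b ⟩
    b ∎

  -- The recurrence for D_s and the sums E_i, O_i, with q n standing for qⁿ and vanishing above
  -- degree N

  module RogersRamanujan
    (q : ℕ → Carrier) (q-0 : q 0 ≈ 1#) (q-+ : ∀ m n → q m * q n ≈ q (m ℕ.+ n))
    (N : ℕ) (q-vanish : ∀ {n} → N < n → q n ≈ 0#)
    where

    D : ℕ → Carrier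
    D zero          = 1#
    D (suc zero)    = 1#
    D (suc (suc n)) = D (suc n) + q (suc (suc n)) * D n

    -- For g n = 1/(q⁴;q⁴)_n these are the partial sums of the series in the theorem.
    slaterSum : (ℕ → Carrier) → ℕ → Carrier
    slaterSum g zero    = 0#
    slaterSum g (suc n) = slaterSum g n + q (n ℕ.* n ℕ.+ 2 ℕ.* n) * g n

    module Unrolling
      (e w : ℕ → Carrier)
      (e-0 : e 0 ≈ 1#)
      (e-suc : ∀ n → e (suc n) ≈ e n + q (suc n ℕ.* 2) * e (suc n))
      (w-suc : ∀ j → w j ≈ w (suc j) + q (suc j ℕ.* 2) * w (suc j))
      (w-large : ∀ {j} → N ≤ j → w j ≈ 1#)
      where

      exponent : ℕ → ℕ → ℕ
      exponent i n = n ℕ.* n ℕ.+ suc i ℕ.* 2 ℕ.* n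

      term : ℕ → ℕ → ℕ → Carrier
      term i j n = q (exponent i n) * (e n * w j)

      -- For e n = 1/(q²;q²)_n and w j = (-q^{2j+2};q²)_∞, these are the sums over the first n
      -- indices in the series E_i and O_i of the header.
      E O : ℕ → ℕ → Carrier
      E zero    i = 0#
      E (suc n) i = E n i + term i (i ℕ.+ n) n
      O zero    i = 0#
      O (suc n) i = O n i + term i (suc i ℕ.+ n) n

      q-regroup : ∀ {a b c d} → a ℕ.+ b ≡ c ℕ.+ d → q a * q b ≈ q c * q d
      q-regroup {a} {b} {c} {d} eq = begin
        q a * q b    ≈⟨ q-+ a b ⟩
        q (a ℕ.+ b)  ≡⟨ cong q eq ⟩
        q (c ℕ.+ d)  ≈⟨ ≈-sym (q-+ c d) ⟩
        q c * q d    ∎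

      -- Holds term by term: splitting off the first factor of `w (i + n)` leaves the term of O_i,
      -- plus that term times q^{2(i+n)+2}. The latter is q^{2i+2} times the n-th term of E_{i+1},
      -- because the exponents agree.
      E-split : ∀ n i → E n i ≈ O n i + q (suc i ℕ.* 2) * E n (suc i)
      E-split zero    i = ≈-sym (≈-trans (+-identityˡ _) (zeroʳ _))
      E-split (suc n) i = begin
        E n i + q (exponent i n) * (e n * w (i ℕ.+ n))
          ≈⟨ +-cong (E-split n i) (*-congˡ (*-congˡ (w-suc (i ℕ.+ n)))) ⟩
        (O n i + Q * E n (suc i)) + q (exponent i n) * (e n * (W + q (suc (i ℕ.+ n) ℕ.* 2) * W))
          ≈⟨ solve 7 (λ o Q E₁ x y e W →
               (o :+ Q :* E₁) :+ x :* (e :* (W :+ y :* W)) := (o :+ x :* (e :* W)) :+ (Q :* E₁ :+ (x :* y) :* (e :* W)))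
               ≈-refl (O n i) Q (E n (suc i)) (q (exponent i n)) (q (suc (i ℕ.+ n) ℕ.* 2)) (e n) W ⟩
        (O n i + term i (suc i ℕ.+ n) n) + (Q * E n (suc i) + (q (exponent i n) * q (suc (i ℕ.+ n) ℕ.* 2)) * (e n * W))
          ≈⟨ +-congˡ (+-congˡ (*-congʳ (q-regroup (exponents i n)))) ⟩
        (O n i + term i (suc i ℕ.+ n) n) + (Q * E n (suc i) + (Q * q (exponent (suc i) n)) * (e n * W))
          ≈⟨ +-congˡ (solve 4 (λ Q E₁ x y → Q :* E₁ :+ (Q :* x) :* y := Q :* (E₁ :+ x :* y))
               ≈-refl Q (E n (suc i)) (q (exponent (suc i) n)) (e n * W)) ⟩
        (O n i + term i (suc i ℕ.+ n) n) + Q * (E n (suc i) + term (suc i) (suc i ℕ.+ n) n) ∎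
        where
        W = w (suc (i ℕ.+ n))
        Q = q (suc i ℕ.* 2)
        exponents : ∀ i n → (n ℕ.* n ℕ.+ suc i ℕ.* 2 ℕ.* n) ℕ.+ suc (i ℕ.+ n) ℕ.* 2 ≡
                            suc i ℕ.* 2 ℕ.+ (n ℕ.* n ℕ.+ suc (suc i) ℕ.* 2 ℕ.* n)
        exponents = solve-∀

      -- Here `e` is split instead of `w`. In the term of index n+1, the part q^{2n+2} e_{n+1} of
      -- e_n + q^{2n+2} e_{n+1} raises the exponent to that of E_{i+1}, while the part e_n gives
      -- q^{2i+3} times the term of O_{i+1} of index n. This shift is why `O` has one term fewer on
      -- the right.
      O-split : ∀ n i → O (suc n) i ≈ E (suc n) (suc i) + q (suc (suc i ℕ.* 2)) * O n (suc i)
      O-split zero    i = begin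
        0# + term i (suc i ℕ.+ 0) 0
          ≡⟨ cong (λ x → 0# + q x * (e 0 * w (suc i ℕ.+ 0))) (exponents i) ⟩
        0# + term (suc i) (suc i ℕ.+ 0) 0
          ≈⟨ ≈-sym (≈-trans (+-congˡ (zeroʳ _)) (+-identityʳ _)) ⟩
        0# + term (suc i) (suc i ℕ.+ 0) 0 + q (suc (suc i ℕ.* 2)) * 0# ∎
        where
        exponents : ∀ i → 0 ℕ.+ suc i ℕ.* 2 ℕ.* 0 ≡ 0 ℕ.+ suc (suc i) ℕ.* 2 ℕ.* 0
        exponents = solve-∀
      O-split (suc n) i = begin
        O (suc n) i + X * (e (suc n) * W)
          ≈⟨ +-cong (O-split n i) (*-congˡ (*-congʳ (e-suc n))) ⟩
        (E (suc n) (suc i) + Q * O n (suc i)) + X * ((e n + q (suc n ℕ.* 2) * e (suc n)) * W)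
          ≈⟨ solve 8 (λ E₁ Q O₁ X e y e₁ W →
               (E₁ :+ Q :* O₁) :+ X :* ((e :+ y :* e₁) :* W) :=
               (E₁ :+ (X :* y) :* (e₁ :* W)) :+ (Q :* O₁ :+ X :* (e :* W)))
               ≈-refl (E (suc n) (suc i)) Q (O n (suc i)) X (e n) (q (suc n ℕ.* 2)) (e (suc n)) W ⟩
        (E (suc n) (suc i) + (X * q (suc n ℕ.* 2)) * (e (suc n) * W)) + (Q * O n (suc i) + X * (e n * W))
          ≈⟨ +-cong (+-congˡ (*-congʳ (q-+′ (exponents₁ i n))))
               (+-congˡ (*-cong (≈-sym (q-+′ (exponents₂ i n)))
                 (*-congˡ (reflexive (cong (λ m → w (suc m)) (ℕₚ.+-suc i n)))))) ⟩
        (E (suc n) (suc i) + term (suc i) (suc i ℕ.+ suc n) (suc n)) +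
        (Q * O n (suc i) + (Q * q (exponent (suc i) n)) * (e n * w (suc (suc i) ℕ.+ n)))
          ≈⟨ +-congˡ (solve 4 (λ Q E₁ x y → Q :* E₁ :+ (Q :* x) :* y := Q :* (E₁ :+ x :* y))
               ≈-refl Q (O n (suc i)) (q (exponent (suc i) n)) (e n * w (suc (suc i) ℕ.+ n))) ⟩
        E (suc (suc n)) (suc i) + Q * O (suc n) (suc i) ∎
        where
        X = q (exponent i (suc n))
        W = w (suc i ℕ.+ suc n)
        Q = q (suc (suc i ℕ.* 2))
        q-+′ : ∀ {a b c} → a ℕ.+ b ≡ c → q a * q b ≈ q c
        q-+′ {a} {b} eq = ≈-trans (q-+ a b) (reflexive (cong q eq))
        exponents₁ : ∀ i n → (suc n ℕ.* suc n ℕ.+ suc i ℕ.* 2 ℕ.* suc n) ℕ.+ suc n ℕ.* 2 ≡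
                             suc n ℕ.* suc n ℕ.+ suc (suc i) ℕ.* 2 ℕ.* suc n
        exponents₁ = solve-∀
        exponents₂ : ∀ i n → suc (suc i ℕ.* 2) ℕ.+ (n ℕ.* n ℕ.+ suc (suc i) ℕ.* 2 ℕ.* n) ≡
                             suc n ℕ.* suc n ℕ.+ suc i ℕ.* 2 ℕ.* suc n
        exponents₂ = solve-∀

      vanish-* : ∀ {n} → N < n → ∀ x → q n * x ≈ 0#
      vanish-* N<n x = ≈-trans (*-congʳ (q-vanish N<n)) (zeroˡ x)

      -- The term missing from `O-split` at n = N has an exponent above N, so it can be added
      -- freely; all sums then have the same N+1 terms and the recurrences can be iterated.
      O-split-full : ∀ i → O (suc N) i ≈ E (suc N) (suc i) + q (suc (suc i ℕ.* 2)) * O (suc N) (suc i)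
      O-split-full i = ≈-trans (O-split N i) (+-congˡ (begin
        Q * O N (suc i)
          ≈⟨ ≈-sym (+-identityʳ _) ⟩
        Q * O N (suc i) + 0#
          ≈⟨ +-congˡ (≈-sym (vanish-* N<s _)) ⟩
        Q * O N (suc i) + q s * (e N * w j)
          ≈⟨ +-congˡ (*-congʳ (≈-sym (q-+ (suc (suc i ℕ.* 2)) (exponent (suc i) N)))) ⟩
        Q * O N (suc i) + (Q * q (exponent (suc i) N)) * (e N * w j)
          ≈⟨ solve 4 (λ Q E₁ x y → Q :* E₁ :+ (Q :* x) :* y := Q :* (E₁ :+ x :* y))
               ≈-refl Q (O N (suc i)) (q (exponent (suc i) N)) (e N * w j) ⟩
        Q * O (suc N) (suc i) ∎))
        where
        Q = q (suc (suc i ℕ.* 2))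
        j = suc (suc i) ℕ.+ N
        s = suc (suc i ℕ.* 2) ℕ.+ exponent (suc i) N
        N<s : N < s
        N<s = s≤s (ℕₚ.m≤n⇒m≤o+n (suc i ℕ.* 2) (ℕₚ.m≤n⇒m≤o+n (N ℕ.* N) (ℕₚ.m≤n*m N (suc (suc i) ℕ.* 2))))

      -- Every term of positive index has an exponent of at least 2i+2 > N, so only the term of
      -- index 0 survives.
      O-large : ∀ n i → N ≤ i → O (suc n) i ≈ 1#
      O-large zero    i N≤i = begin
        0# + q (exponent i 0) * (e 0 * w (suc i ℕ.+ 0))
          ≈⟨ +-identityˡ _ ⟩
        q (exponent i 0) * (e 0 * w (suc i ℕ.+ 0))
          ≈⟨ *-cong (≈-trans (reflexive (cong q (ℕₚ.*-zeroʳ (suc i ℕ.* 2)))) q-0)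
               (*-cong e-0 (w-large (ℕₚ.m≤n⇒m≤n+o 0 (ℕₚ.m≤n⇒m≤1+n N≤i)))) ⟩
        1# * (1# * 1#)
          ≈⟨ ≈-trans (*-identityˡ _) (*-identityˡ _) ⟩
        1# ∎
      O-large (suc n) i N≤i = ≈-trans (+-cong (O-large n i N≤i) (vanish-* N<x _)) (+-identityʳ 1#)
        where
        N<x : N < exponent i (suc n)
        N<x = ℕₚ.m≤n⇒m≤o+n (suc n ℕ.* suc n) (ℕₚ.≤-trans (s≤s N≤i)
          (ℕₚ.≤-trans (ℕₚ.m≤m*n (suc i) 2) (ℕₚ.m≤m*n (suc i ℕ.* 2) (suc n))))

      -- `O-split-full` turns the coefficient of E_{i+1} into D_{2i+1} + q^{2i+2} D_{2i} = D_{2i+2}.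
      -- Then `E-split` turns the coefficient of O_{i+1} into D_{2i+2} + q^{2i+3} D_{2i+1} =
      -- D_{2i+3}. One step in i is thus two steps of the recurrence.
      unroll : ∀ i → E (suc N) 0 ≈ D (suc (i ℕ.* 2)) * O (suc N) i
                                   + q (suc i ℕ.* 2) * (D (i ℕ.* 2) * E (suc N) (suc i))
      unroll zero    = ≈-trans (E-split (suc N) 0)
        (+-cong (≈-sym (*-identityˡ _)) (*-congˡ (≈-sym (*-identityˡ _))))
      unroll (suc i) = begin
        E (suc N) 0
          ≈⟨ unroll i ⟩
        D₁ * O (suc N) i + q₂ * (D₀ * E₁)
          ≈⟨ +-congʳ (*-congˡ (O-split-full i)) ⟩
        D₁ * (E₁ + q₃ * O₁) + q₂ * (D₀ * E₁)
          ≈⟨ solve 6 (λ D₀ D₁ E₁ O₁ q₂ q₃ →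
               D₁ :* (E₁ :+ q₃ :* O₁) :+ q₂ :* (D₀ :* E₁) :=
               (D₁ :+ q₂ :* D₀) :* E₁ :+ q₃ :* D₁ :* O₁) ≈-refl D₀ D₁ E₁ O₁ q₂ q₃ ⟩
        (D₁ + q₂ * D₀) * E₁ + q₃ * D₁ * O₁
          ≈⟨ +-congʳ (*-congˡ (E-split (suc N) (suc i))) ⟩
        (D₁ + q₂ * D₀) * (O₁ + q₄ * E₂) + q₃ * D₁ * O₁
          ≈⟨ solve 7 (λ D₁ D₂ E₂ O₁ q₂ q₃ q₄ →
               D₂ :* (O₁ :+ q₄ :* E₂) :+ q₃ :* D₁ :* O₁ :=
               (D₂ :+ q₃ :* D₁) :* O₁ :+ q₄ :* (D₂ :* E₂)) ≈-refl D₁ (D₁ + q₂ * D₀) E₂ O₁ q₂ q₃ q₄ ⟩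
        (D₁ + q₂ * D₀ + q₃ * D₁) * O₁ + q₄ * ((D₁ + q₂ * D₀) * E₂) ∎
        where
        D₀ = D (i ℕ.* 2)
        D₁ = D (suc (i ℕ.* 2))
        E₁ = E (suc N) (suc i)
        E₂ = E (suc N) (suc (suc i))
        O₁ = O (suc N) (suc i)
        q₂ = q (suc i ℕ.* 2)
        q₃ = q (suc (suc i ℕ.* 2))
        q₄ = q (suc (suc i) ℕ.* 2)

      E≈D : ∀ i → N ≤ i → E (suc N) 0 ≈ D (suc (i ℕ.* 2))
      E≈D i N≤i = begin
        E (suc N) 0
          ≈⟨ unroll i ⟩
        D (suc (i ℕ.* 2)) * O (suc N) i + q (suc i ℕ.* 2) * (D (i ℕ.* 2) * E (suc N) (suc i))
          ≈⟨ +-cong (≈-trans (*-congˡ (O-large N i N≤i)) (*-identityʳ _))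
               (vanish-* (ℕₚ.≤-trans (s≤s N≤i) (ℕₚ.m≤m*n (suc i) 2)) _) ⟩
        D (suc (i ℕ.* 2)) + 0#
          ≈⟨ +-identityʳ _ ⟩
        D (suc (i ℕ.* 2)) ∎

      E≈slaterSum : ∀ {g} → (∀ n → e n * w n ≈ w 0 * g n) → ∀ n → E n 0 ≈ w 0 * slaterSum g n
      E≈slaterSum     e*w zero    = ≈-sym (zeroʳ _)
      E≈slaterSum {g} e*w (suc n) = begin
        E n 0 + q (exponent 0 n) * (e n * w n)
          ≈⟨ +-cong (E≈slaterSum e*w n) (*-congˡ (e*w n)) ⟩
        w 0 * slaterSum g n + q (exponent 0 n) * (w 0 * g n)
          ≈⟨ solve 4 (λ w s x g → w :* s :+ x :* (w :* g) := w :* (s :+ x :* g))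
               ≈-refl (w 0) (slaterSum g n) (q (exponent 0 n)) (g n) ⟩
        w 0 * (slaterSum g n + q (exponent 0 n) * g n) ∎

    module Counting
      (a b P r : ℕ → Carrier)
      (P-0 : P 0 ≈ 1#)
      (P-suc : ∀ n → P (suc n) ≈ P n * r n)
      (a-eq : ∀ n → r (suc n) * a n ≈ b n)
      (b-0 : r 0 * b 0 ≈ 1#)
      (b-1 : r 1 * b 1 ≈ b 0)
      (b-eq : ∀ n → r (suc (suc n)) * b (suc (suc n)) ≈ b (suc n) + q (suc (suc n)) * a n)
      where

      P*b-suc : ∀ n {x} → r n * b n ≈ x → P (suc n) * b n ≈ P n * x
      P*b-suc n eq = ≈-trans (*-congʳ (P-suc n)) (≈-trans (*-assoc _ _ _) (*-congˡ eq))

      -- P (n+1) = (q;q)_{n+1} clears all denominators of `b n`. In the summand q^{n+2} a_n of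
      -- `b-eq`, the last factor of P (n+2) cancels the denominator of `a n` and leaves P (n+1) b_n,
      -- which is D_n again.
      P*b≈D : ∀ n → P (suc n) * b n ≈ D n
      P*b≈D zero          = ≈-trans (P*b-suc 0 b-0) (≈-trans (*-identityʳ _) P-0)
      P*b≈D (suc zero)    = ≈-trans (P*b-suc 1 b-1) (P*b≈D 0)
      P*b≈D (suc (suc n)) = begin
        P (3 ℕ.+ n) * b (2 ℕ.+ n)
          ≈⟨ P*b-suc (2 ℕ.+ n) (b-eq n) ⟩
        P (2 ℕ.+ n) * (b (suc n) + q (2 ℕ.+ n) * a n)
          ≈⟨ distribˡ _ _ _ ⟩
        P (2 ℕ.+ n) * b (suc n) + P (2 ℕ.+ n) * (q (2 ℕ.+ n) * a n)
          ≈⟨ +-cong (P*b≈D (suc n)) (*-congʳ (P-suc (suc n))) ⟩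
        D (suc n) + P (suc n) * r (suc n) * (q (2 ℕ.+ n) * a n)
          ≈⟨ +-congˡ (solve 4 (λ P r q a → P :* r :* (q :* a) := q :* (P :* (r :* a)))
               ≈-refl (P (suc n)) (r (suc n)) (q (2 ℕ.+ n)) (a n)) ⟩
        D (suc n) + q (2 ℕ.+ n) * (P (suc n) * (r (suc n) * a n))
          ≈⟨ +-congˡ (*-congˡ (≈-trans (*-congˡ (a-eq n)) (P*b≈D n))) ⟩
        D (suc n) + q (2 ℕ.+ n) * D n ∎

    q-double : ∀ n → q (n ℕ.* 2) * q (n ℕ.* 2) ≈ q (n ℕ.* 4)
    q-double n = ≈-trans (q-+ (n ℕ.* 2) (n ℕ.* 2)) (reflexive (cong q (sym (ℕₚ.*-distribˡ-+ n 2 2))))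

    -- (-q^{2j+2};q²)_m, which does not depend on m as long as m + j ≥ N.
    tailProduct : ℕ → ℕ → Carrier
    tailProduct zero    j = 1#
    tailProduct (suc m) j = (1# + q (suc j ℕ.* 2)) * tailProduct m (suc j)

    tailProduct-large : ∀ m {j} → N ≤ j → tailProduct m j ≈ 1#
    tailProduct-large zero        N≤j = ≈-refl
    tailProduct-large (suc m) {j} N≤j = begin
      (1# + q (suc j ℕ.* 2)) * tailProduct m (suc j)
        ≈⟨ *-cong (+-congˡ (q-vanish (ℕₚ.≤-trans (s≤s N≤j) (ℕₚ.m≤m*n (suc j) 2))))
             (tailProduct-large m (ℕₚ.m≤n⇒m≤1+n N≤j)) ⟩
      (1# + 0#) * 1#
        ≈⟨ ≈-trans (*-identityʳ _) (+-identityʳ 1#) ⟩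
      1# ∎

    tailProduct-stable : ∀ m j → N ≤ m ℕ.+ j → tailProduct (suc m) j ≈ tailProduct m j
    tailProduct-stable zero    j N≤j = tailProduct-large 1 N≤j
    tailProduct-stable (suc m) j N≤  =
      *-congˡ (tailProduct-stable m (suc j) (ℕₚ.≤-trans N≤ (ℕₚ.≤-reflexive (sym (ℕₚ.+-suc m j)))))

    module Slater
      (W P₄ I₄ : ℕ → Carrier)
      (W-0 : W 0 ≈ 1#) (W-suc : ∀ n → W (suc n) ≈ W n * (1# + q (suc n ℕ.* 2)))
      (P₄-0 : P₄ 0 ≈ 1#) (P₄-suc : ∀ n → P₄ (suc n) ≈ P₄ n * (1# + - q (suc n ℕ.* 4)))
      (P₄*I₄ : ∀ n → P₄ n * I₄ n ≈ 1#)
      where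

      -- `e n` is 1/(q²;q²)_n, written as (-q²;q²)_n / (q⁴;q⁴)_n so that the only inverses involved
      -- are those occurring in the theorem.
      w e : ℕ → Carrier
      w = tailProduct N
      e n = W n * I₄ n

      w-suc : ∀ j → w j ≈ w (suc j) + q (suc j ℕ.* 2) * w (suc j)
      w-suc j = begin
        tailProduct N j
          ≈⟨ ≈-sym (tailProduct-stable N j (ℕₚ.m≤m+n N j)) ⟩
        (1# + q (suc j ℕ.* 2)) * w (suc j)
          ≈⟨ ≈-trans (distribʳ _ _ _) (+-congʳ (*-identityˡ _)) ⟩
        w (suc j) + q (suc j ℕ.* 2) * w (suc j) ∎

      W*w : ∀ n → W n * w n ≈ w 0
      W*w zero    = ≈-trans (*-congʳ W-0) (*-identityˡ _)
      W*w (suc n) = begin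
        W (suc n) * w (suc n)
          ≈⟨ *-congʳ (W-suc n) ⟩
        W n * (1# + q (suc n ℕ.* 2)) * w (suc n)
          ≈⟨ solve 3 (λ W x w → W :* (con 1 :+ x) :* w := W :* (w :+ x :* w)) ≈-refl
               (W n) (q (suc n ℕ.* 2)) (w (suc n)) ⟩
        W n * (w (suc n) + q (suc n ℕ.* 2) * w (suc n))
          ≈⟨ *-congˡ (≈-sym (w-suc n)) ⟩
        W n * w n
          ≈⟨ W*w n ⟩
        w 0 ∎

      I₄-suc : ∀ n → I₄ n ≈ (1# + - q (suc n ℕ.* 4)) * I₄ (suc n)
      I₄-suc n = begin
        I₄ n                                        ≈⟨ ≈-sym (*-identityʳ _) ⟩
        I₄ n * 1#                                   ≈⟨ *-congˡ (≈-sym (P₄*I₄ (suc n))) ⟩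
        I₄ n * (P₄ (suc n) * I₄ (suc n))            ≈⟨ *-congˡ (*-congʳ (P₄-suc n)) ⟩
        I₄ n * (P₄ n * x * I₄ (suc n))              ≈⟨ solve 4 (λ i P x j → i :* (P :* x :* j) := (P :* i) :* (x :* j))
                                                         ≈-refl (I₄ n) (P₄ n) x (I₄ (suc n)) ⟩
        (P₄ n * I₄ n) * (x * I₄ (suc n))            ≈⟨ ≈-trans (*-congʳ (P₄*I₄ n)) (*-identityˡ _) ⟩
        x * I₄ (suc n) ∎
        where x = 1# + - q (suc n ℕ.* 4)

      -- With m = n+1, this is the identity (1 - q^{4m}) + q^{2m} (1 + q^{2m}) = 1 + q^{2m},
      -- multiplied by (-q²;q²)_n / (q⁴;q⁴)_m.
      e-suc : ∀ n → e (suc n) ≈ e n + q (suc n ℕ.* 2) * e (suc n)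
      e-suc n = ≈-sym (begin
        W n * I₄ n + Q * (W (suc n) * I₄ (suc n))
          ≈⟨ +-cong (*-congˡ (I₄-suc n)) (*-congˡ (*-congʳ (W-suc n))) ⟩
        W n * ((1# + - Q₄) * I₄ (suc n)) + Q * (W n * (1# + Q) * I₄ (suc n))
          ≈⟨ solve 4 (λ W x i Q → W :* ((con 1 :+ x) :* i) :+ Q :* (W :* (con 1 :+ Q) :* i) :=
               W :* (con 1 :+ Q :+ (Q :* Q :+ x)) :* i) ≈-refl (W n) (- Q₄) (I₄ (suc n)) Q ⟩
        W n * (1# + Q + (Q * Q + - Q₄)) * I₄ (suc n)
          ≈⟨ *-congʳ (*-congˡ (+-congˡ (≈-trans (+-congʳ (q-double (suc n))) (-‿inverseʳ Q₄)))) ⟩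
        W n * (1# + Q + 0#) * I₄ (suc n)
          ≈⟨ *-congʳ (≈-trans (*-congˡ (+-identityʳ _)) (≈-sym (W-suc n))) ⟩
        W (suc n) * I₄ (suc n) ∎)
        where
        Q = q (suc n ℕ.* 2)
        Q₄ = q (suc n ℕ.* 4)

      e-0 : e 0 ≈ 1#
      e-0 = begin
        W 0 * I₄ 0    ≈⟨ *-congʳ (≈-trans W-0 (≈-sym P₄-0)) ⟩
        P₄ 0 * I₄ 0   ≈⟨ P₄*I₄ 0 ⟩
        1# ∎

      e*w : ∀ n → e n * w n ≈ w 0 * I₄ n
      e*w n = begin
        W n * I₄ n * w n     ≈⟨ solve 3 (λ W i w → W :* i :* w := (W :* w) :* i) ≈-refl (W n) (I₄ n) (w n) ⟩
        (W n * w n) * I₄ n   ≈⟨ *-congʳ (W*w n) ⟩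
        w 0 * I₄ n ∎

      W-full : ∀ {n} → N ≤ n → W n ≈ w 0
      W-full {n} N≤n = begin
        W n          ≈⟨ ≈-sym (*-identityʳ _) ⟩
        W n * 1#     ≈⟨ *-congˡ (≈-sym (tailProduct-large N N≤n)) ⟩
        W n * w n    ≈⟨ W*w n ⟩
        w 0 ∎

      open Unrolling e w e-0 e-suc w-suc (tailProduct-large N)

      W*slaterSum≈D : ∀ i → N ≤ i → W (suc N) * slaterSum I₄ (suc N) ≈ D (suc (i ℕ.* 2))
      W*slaterSum≈D i N≤i = begin
        W (suc N) * slaterSum I₄ (suc N)   ≈⟨ *-congʳ (W-full (ℕₚ.n≤1+n N)) ⟩
        w 0 * slaterSum I₄ (suc N)         ≈⟨ ≈-sym (E≈slaterSum e*w (suc N)) ⟩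
        E (suc N) 0                        ≈⟨ E≈D i N≤i ⟩
        D (suc (i ℕ.* 2)) ∎

-- Truncation of power series

module Truncated (N : ℕ) where
  open CommutativeRing (truncatedRing N) public
    renaming (refl to ≈-refl; sym to ≈-sym; trans to ≈-trans)

  infSum-truncate : ∀ F → (∀ k n → n < k → F k n ≡ + 0) → infSum F ≈ sumₛ (suc N) F
  infSum-truncate F ord n n≤N =
    sym (sumTo-stable (λ k → F k n) (ℕₚ.≤⇒≤′ (s≤s n≤N)) (λ k → ord k n))

  *-inverseʳ : ∀ f → f 0 ≡ + 1 → f * invₛ f ≈ 1#
  *-inverseʳ f f₀ = RingIdentities.geometric-inverse (truncatedRing N) f (u ^ₛ_) (λ k → sumₛ k (u ^ₛ_))
    (λ _ _ → refl) (λ _ _ _ → refl) (λ _ _ → refl) (λ _ _ _ → refl) {suc N} {invₛ f}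
    (λ n n≤N → ^ₛ-< u u₀ (suc N) n (s≤s n≤N)) (infSum-truncate (u ^ₛ_) (^ₛ-< u u₀))
    where
    u = oneₛ -ₛ f
    u₀ : u 0 ≡ + 0
    u₀ = cong (λ x → + 1 ℤ.- x) f₀

  qpow-^ : ∀ m k → qpow m * (qpow m ^ₛ k) ≈ qpow (suc k ℕ.* m)
  qpow-^ m zero    n _   = trans (*ₛ-comm (qpow m) oneₛ n) (trans (*ₛ-identityˡ (qpow m) n)
    (cong (λ j → qpow j n) (sym (ℕₚ.+-identityʳ m))))
  qpow-^ m (suc k) n n≤N = trans (*-congˡ {qpow m} (qpow-^ m k) n n≤N) (qpow-+ m (suc k ℕ.* m) n)

module _ {F : ℕ → Series} (F≡1 : ∀ k n → n ≤ k → F k n ≡ oneₛ n) where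

  finProd-stable : ∀ {m m′} → m ℕ.≤′ m′ → ∀ n → n ≤ m → finProd m′ F n ≡ finProd m F n
  finProd-stable (ℕ.≤′-reflexive refl)  n n≤m = refl
  finProd-stable {m} (ℕ.≤′-step {m′} m≤m′) n n≤m = trans
    -- The extra factor equals 1 only up to degree m′, so it is removed in the ring truncated at the
    -- degree n under consideration.
    (R.≈-trans {finProd (suc m′) F} {finProd m′ F *ₛ oneₛ} {finProd m′ F}
      (R.*-congˡ {finProd m′ F} {F m′} {oneₛ}
        (λ k k≤n → F≡1 m′ k (ℕₚ.≤-trans k≤n (ℕₚ.≤-trans n≤m (ℕₚ.≤′⇒≤ m≤m′)))))
      (R.*-identityʳ (finProd m′ F))
      n ℕₚ.≤-refl)
    (finProd-stable m≤m′ n n≤m)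
    where module R = Truncated n

  infProd-truncate : ∀ {N m} → N < m → ∀ n → n ≤ N → infProd F n ≡ finProd m F n
  infProd-truncate N<m n n≤N =
    sym (finProd-stable (ℕₚ.≤⇒≤′ (ℕₚ.≤-trans (s≤s n≤N) N<m)) n (ℕₚ.n≤1+n n))

-- Counting

module _ {A : Set} where

  HasCount-empty : {P : A → Set} → (∀ x → ¬ P x) → HasCount P 0
  HasCount-empty ¬P = [] , [] , refl , λ x → mk⇔ (λ ()) (⊥-elim ∘ ¬P x)

  HasCount-singleton : {P : A → Set} (a : A) → P a → (∀ x → P x → x ≡ a) → HasCount P 1
  HasCount-singleton a Pa only = a ∷ [] , [] ∷ [] , refl ,
    λ x → mk⇔ (λ { (here refl) → Pa }) (here ∘ only x)

  HasCount-⇔ : {P Q : A → Set} → (∀ x → P x ⇔ Q x) → ∀ {k} → HasCount P k → HasCount Q k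
  HasCount-⇔ P⇔Q (L , unique , len , ∈⇔P) = L , unique , len , λ x →
    mk⇔ (to (P⇔Q x) ∘ to (∈⇔P x)) (from (∈⇔P x) ∘ from (P⇔Q x))
    where open Equivalence

  HasCount-⊎ : {P Q : A → Set} → (∀ x → P x → ¬ Q x) → ∀ {k l} →
    HasCount P k → HasCount Q l → HasCount (λ x → P x ⊎ Q x) (k ℕ.+ l)
  HasCount-⊎ disjoint (L , uniqueL , lenL , ∈L) (M , uniqueM , lenM , ∈M) =
    L ++ M ,
    Uniqueₚ.++⁺ uniqueL uniqueM (λ {x} (x∈L , x∈M) → disjoint x (to (∈L x) x∈L) (to (∈M x) x∈M)) ,
    trans (length-++ L) (cong₂ ℕ._+_ lenL lenM) ,
    λ x → mk⇔ (Sum.map (to (∈L x)) (to (∈M x)) ∘ ∈-++⁻ L)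
              [ ∈-++⁺ˡ ∘ from (∈L x) , ∈-++⁺ʳ L ∘ from (∈M x) ]
    where open Equivalence

  -- The left inverse is asked for on the list only, since `stripAll` undoes `growAll` only on
  -- cylindric tuples that fit the layer.
  unique-map : {B : Set} (f : A → B) (g : B → A) (xs : List A) →
    (∀ x → x ∈ xs → g (f x) ≡ x) → Unique xs → Unique (map f xs)
  unique-map f g []       inverse []              = []
  unique-map f g (x ∷ xs) inverse (x∉xs ∷ unique) =
    Allₚ.map⁺ (All.tabulate λ {y} y∈xs fx≡fy → All.lookup x∉xs y∈xs
      (trans (sym (inverse x (here refl))) (trans (cong g fx≡fy) (inverse y (there y∈xs)))))
    ∷ unique-map f g xs (λ y → inverse y ∘ there) unique

  HasCount-bijection : {B : Set} {P : A → Set} {Q : B → Set} (f : A → B) (g : B → A) →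
    (∀ x → P x → Q (f x)) → (∀ y → Q y → P (g y)) →
    (∀ x → P x → g (f x) ≡ x) → (∀ y → Q y → f (g y) ≡ y) →
    ∀ {k} → HasCount P k → HasCount Q k
  HasCount-bijection {Q = Q} f g f-Q g-P g∘f f∘g (L , unique , len , ∈⇔P) =
    map f L ,
    unique-map f g L (λ x x∈L → g∘f x (to (∈⇔P x) x∈L)) unique ,
    trans (length-map f L) len ,
    λ y → mk⇔ (λ y∈ → let x , x∈L , y≡fx = ∈-map⁻ f y∈ in subst Q (sym y≡fx) (f-Q x (to (∈⇔P x) x∈L)))
              (λ Qy → subst (_∈ map f L) (f∘g y Qy) (∈-map⁺ f (from (∈⇔P (g y)) (g-P y Qy))))
    where open Equivalence

-- strip removes the bottom layer, by subtracting 1 from every part; grow a puts back a bottom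
-- layer of length a, provided that a is at least the number of parts.
strip : List ℕ → List ℕ
strip []                 = []
strip (zero ∷ xs)        = []
strip (suc zero ∷ xs)    = []
strip (suc (suc x) ∷ xs) = suc x ∷ strip xs

grow : ℕ → List ℕ → List ℕ
grow zero    xs       = []
grow (suc a) []       = 1 ∷ grow a []
grow (suc a) (x ∷ xs) = suc x ∷ grow a xs

length-grow : ∀ a xs → length (grow a xs) ≡ a
length-grow zero    xs       = refl
length-grow (suc a) []       = cong suc (length-grow a [])
length-grow (suc a) (x ∷ xs) = cong suc (length-grow a xs)

sum-grow : ∀ {a} xs → length xs ≤ a → sum (grow a xs) ≡ a ℕ.+ sum xs
sum-grow {zero}  []       _         = refl
sum-grow {suc a} []       _         = cong suc (sum-grow {a} [] z≤n)
sum-grow {suc a} (x ∷ xs) (s≤s len) = cong suc (begin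
  x ℕ.+ sum (grow a xs)    ≡⟨ cong (x ℕ.+_) (sum-grow xs len) ⟩
  x ℕ.+ (a ℕ.+ sum xs)     ≡⟨ swap x a (sum xs) ⟩
  a ℕ.+ (x ℕ.+ sum xs)     ∎)
  where
  open ≡-Reasoning
  swap : ∀ x a s → x ℕ.+ (a ℕ.+ s) ≡ a ℕ.+ (x ℕ.+ s)
  swap = solve-∀

part-grow : ∀ {a j} xs → j < a → part (grow a xs) j ≡ suc (part xs j)
part-grow {suc a} {zero}  []       _         = refl
part-grow {suc a} {suc j} []       (s≤s j<a) = part-grow [] j<a
part-grow {suc a} {zero}  (x ∷ xs) _         = refl
part-grow {suc a} {suc j} (x ∷ xs) (s≤s j<a) = part-grow xs j<a

part-beyond : ∀ xs {j} → length xs ≤ j → part xs j ≡ 0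
part-beyond []       _         = refl
part-beyond (x ∷ xs) (s≤s len) = part-beyond xs len

part-positive : ∀ {xs j} → All (0 <_) xs → j < length xs → 0 < part xs j
part-positive {j = zero}  (0<x ∷ _) _       = 0<x
part-positive {j = suc j} (_ ∷ 0<xs) (s≤s j<) = part-positive 0<xs j<

Linked-grow : ∀ a {xs} → Linked _≥_ xs → Linked _≥_ (grow a xs)
Linked-grow zero          _            = []
Linked-grow (suc zero)    []           = [-]
Linked-grow (suc (suc a)) []           = s≤s z≤n ∷ Linked-grow (suc a) []
Linked-grow (suc zero)    [-]          = [-]
Linked-grow (suc (suc a)) [-]          = s≤s z≤n ∷ Linked-grow (suc a) []
Linked-grow (suc zero)    (_ ∷ _)      = [-]
Linked-grow (suc (suc a)) (x≥y ∷ link) = s≤s x≥y ∷ Linked-grow (suc a) link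

positive-grow : ∀ a xs → All (0 <_) (grow a xs)
positive-grow zero    xs       = []
positive-grow (suc a) []       = s≤s z≤n ∷ positive-grow a []
positive-grow (suc a) (x ∷ xs) = s≤s z≤n ∷ positive-grow a xs

IsPartition-grow : ∀ a {xs} → IsPartition xs → IsPartition (grow a xs)
IsPartition-grow a (link , _) = Linked-grow a link , positive-grow a _

Linked-strip : ∀ {xs} → Linked _≥_ xs → Linked _≥_ (strip xs)
Linked-strip []                                      = []
Linked-strip {zero ∷ _}                    _         = []
Linked-strip {suc zero ∷ _}                _         = []
Linked-strip {suc (suc x) ∷ []}            [-]       = [-]
Linked-strip {suc (suc x) ∷ zero ∷ _}          _     = [-]
Linked-strip {suc (suc x) ∷ suc zero ∷ _}      _     = [-]
Linked-strip {suc (suc x) ∷ suc (suc y) ∷ _} (s≤s x≥y ∷ link) = x≥y ∷ Linked-strip link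

positive-strip : ∀ xs → All (0 <_) (strip xs)
positive-strip []                 = []
positive-strip (zero ∷ xs)        = []
positive-strip (suc zero ∷ xs)    = []
positive-strip (suc (suc x) ∷ xs) = s≤s z≤n ∷ positive-strip xs

IsPartition-strip : ∀ {xs} → IsPartition xs → IsPartition (strip xs)
IsPartition-strip {xs} (link , _) = Linked-strip link , positive-strip xs

length-strip : ∀ xs → length (strip xs) ≤ length xs
length-strip []                 = z≤n
length-strip (zero ∷ xs)        = z≤n
length-strip (suc zero ∷ xs)    = z≤n
length-strip (suc (suc x) ∷ xs) = s≤s (length-strip xs)

Linked-tail : ∀ {x} {xs : List ℕ} → Linked _≥_ (x ∷ xs) → Linked _≥_ xs
Linked-tail [-]        = []
Linked-tail (_ ∷ link) = link

part-≤-head : ∀ {x xs} → Linked _≥_ (x ∷ xs) → ∀ j → part (x ∷ xs) j ≤ x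
part-≤-head link                 zero    = ℕₚ.≤-refl
part-≤-head [-]                  (suc j) = z≤n
part-≤-head (x≥y ∷ link)         (suc j) = ℕₚ.≤-trans (part-≤-head link j) x≥y

-- `strip` stops at the first part that is at most 1. By monotonicity all later parts are at most 1
-- too, so their predecessors are 0, the value of `part` beyond the end.
part-strip : ∀ {xs} → Linked _≥_ xs → ∀ j → part (strip xs) j ≡ ℕ.pred (part xs j)
part-strip []                              j       = refl
part-strip {zero ∷ xs}        link         j       = sym (cong ℕ.pred (ℕₚ.n≤0⇒n≡0 (part-≤-head link j)))
part-strip {suc zero ∷ xs}    link         j       = sym (ℕₚ.n≤0⇒n≡0 (ℕₚ.pred-mono-≤ (part-≤-head link j)))
part-strip {suc (suc x) ∷ xs} link         zero    = refl
part-strip {suc (suc x) ∷ xs} link         (suc j) = part-strip (Linked-tail link) j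

strip-grow : ∀ {a xs} → All (0 <_) xs → length xs ≤ a → strip (grow a xs) ≡ xs
strip-grow {zero}  []             _         = refl
strip-grow {suc a} []             _         = refl
strip-grow {suc a} (s≤s z≤n ∷ 0<) (s≤s len) = cong (_ ∷_) (strip-grow 0< len)

grow-ones : ∀ {xs} → Linked _≥_ (1 ∷ xs) → All (0 <_) xs → grow (length xs) [] ≡ xs
grow-ones [-]                  []             = refl
grow-ones (s≤s z≤n ∷ link)     (s≤s z≤n ∷ 0<) = cong (1 ∷_) (grow-ones link 0<)

grow-strip : ∀ {xs} → Linked _≥_ xs → All (0 <_) xs → grow (length xs) (strip xs) ≡ xs
grow-strip                      []   _        = refl
grow-strip {suc zero ∷ xs}      link (_ ∷ 0<) = cong (1 ∷_) (grow-ones link 0<)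
grow-strip {suc (suc x) ∷ xs}   link (_ ∷ 0<) = cong (suc (suc x) ∷_) (grow-strip (Linked-tail link) 0<)

-- The inequality between cyclically neighbouring components

Dominates : ℕ → List ℕ → List ℕ → Set
Dominates d xs ys = ∀ j → part xs j ≥ part ys (j ℕ.+ d)

-- At index `length xs` the left side is 0, so the positive parts of `ys` must have ended by index
-- `length xs + d`.
Dominates-length : ∀ d xs {ys} → All (0 <_) ys → Dominates d xs ys → length ys ≤ d ℕ.+ length xs
Dominates-length d xs {ys} 0<ys dom = ℕₚ.≮⇒≥ λ d+l< →
  ℕₚ.<⇒≱ (part-positive 0<ys (subst (_< length ys) (ℕₚ.+-comm d (length xs)) d+l<))
    (ℕₚ.≤-trans (dom (length xs)) (ℕₚ.≤-reflexive (part-beyond xs ℕₚ.≤-refl)))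

Dominates-strip : ∀ d {xs ys} → Linked _≥_ xs → Linked _≥_ ys → Dominates d xs ys → Dominates d (strip xs) (strip ys)
Dominates-strip d {xs} {ys} linkX linkY dom j = begin
  part (strip ys) (j ℕ.+ d)      ≡⟨ part-strip linkY (j ℕ.+ d) ⟩
  ℕ.pred (part ys (j ℕ.+ d))     ≤⟨ ℕₚ.pred-mono-≤ (dom j) ⟩
  ℕ.pred (part xs j)             ≡⟨ sym (part-strip linkX j) ⟩
  part (strip xs) j              ∎
  where open ℕₚ.≤-Reasoning

-- Where the new layer of `ys` reaches index j + d, the bound b ≤ d + a makes the new layer of `xs`
-- reach j, so both parts rise by 1. Elsewhere the part of `ys` is 0.
Dominates-grow : ∀ d {a b} xs ys → b ≤ d ℕ.+ a → Dominates d xs ys → Dominates d (grow a xs) (grow b ys)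
Dominates-grow d {a} {b} xs ys b≤d+a dom j with j ℕ.+ d ℕ.<? b
... | yes j+d<b = begin
  part (grow b ys) (j ℕ.+ d)     ≡⟨ part-grow ys j+d<b ⟩
  suc (part ys (j ℕ.+ d))        ≤⟨ s≤s (dom j) ⟩
  suc (part xs j)                ≡⟨ sym (part-grow xs j<a) ⟩
  part (grow a xs) j             ∎
  where
  open ℕₚ.≤-Reasoning
  j<a : j < a
  j<a = ℕₚ.+-cancelʳ-< d j a (ℕₚ.<-≤-trans j+d<b (ℕₚ.≤-trans b≤d+a (ℕₚ.≤-reflexive (ℕₚ.+-comm d a))))
... | no j+d≮b = ℕₚ.≤-trans (ℕₚ.≤-reflexive (part-beyond (grow b ys)
  (ℕₚ.≤-trans (ℕₚ.≤-reflexive (length-grow b ys)) (ℕₚ.≮⇒≥ j+d≮b)))) z≤n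

length≤sum : ∀ {xs} → All (0 <_) xs → length xs ≤ sum xs
length≤sum []         = z≤n
length≤sum (0<x ∷ 0<) = ℕₚ.+-mono-≤ 0<x (length≤sum 0<)

-- Cylindric partitions of profile (2,0,0)

Layer : Set
Layer = ℕ × ℕ × ℕ

Valid : Layer → Set
Valid (a , b , c) = b ≤ a × c ≤ b × a ≤ 2 ℕ.+ c

infix 4 _≼_
_≼_ : Layer → Layer → Set
(a , b , c) ≼ (a′ , b′ , c′) = a ≤ a′ × b ≤ b′ × c ≤ c′

∣_∣ : Layer → ℕ
∣ a , b , c ∣ = a ℕ.+ (b ℕ.+ (c ℕ.+ 0))

≼-refl : ∀ {l} → l ≼ l
≼-refl = ℕₚ.≤-refl , ℕₚ.≤-refl , ℕₚ.≤-refl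

≼-trans : ∀ {l m n} → l ≼ m → m ≼ n → l ≼ n
≼-trans (p , q , r) (p′ , q′ , r′) = ℕₚ.≤-trans p p′ , ℕₚ.≤-trans q q′ , ℕₚ.≤-trans r r′

∣∣-mono : ∀ {l m} → l ≼ m → ∣ l ∣ ≤ ∣ m ∣
∣∣-mono (p , q , r) = ℕₚ.+-mono-≤ p (ℕₚ.+-mono-≤ q (ℕₚ.+-monoˡ-≤ 0 r))

-- In the notation of the header, A n 0 = A_{n+2} and B n 0 = B_{n+1}. The second argument is
-- the number of boxes added to each coordinate.
A B : ℕ → ℕ → Layer
A 0 c                   = 2 ℕ.+ c , c , c
A 1 c                   = 1 ℕ.+ c , 1 ℕ.+ c , 1 ℕ.+ c
A 2 c                   = 2 ℕ.+ c , 2 ℕ.+ c , c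
A (suc (suc (suc n))) c = A n (suc c)
B 0 c                   = 1 ℕ.+ c , c , c
B 1 c                   = 1 ℕ.+ c , 1 ℕ.+ c , c
B 2 c                   = 2 ℕ.+ c , 1 ℕ.+ c , c
B (suc (suc (suc n))) c = B n (suc c)

Valid-A : ∀ n c → Valid (A n c)
Valid-A 0 c = ℕₚ.m≤n+m c 2 , ℕₚ.≤-refl , ℕₚ.≤-refl
Valid-A 1 c = ℕₚ.≤-refl , ℕₚ.≤-refl , ℕₚ.m≤n+m (suc c) 2
Valid-A 2 c = ℕₚ.≤-refl , ℕₚ.m≤n+m c 2 , ℕₚ.≤-refl
Valid-A (suc (suc (suc n))) c = Valid-A n (suc c)

Valid-B : ∀ n c → Valid (B n c)
Valid-B 0 c = ℕₚ.n≤1+n c , ℕₚ.≤-refl , ℕₚ.n≤1+n (suc c)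
Valid-B 1 c = ℕₚ.≤-refl , ℕₚ.n≤1+n c , ℕₚ.n≤1+n (suc c)
Valid-B 2 c = ℕₚ.n≤1+n (suc c) , ℕₚ.n≤1+n c , ℕₚ.≤-refl
Valid-B (suc (suc (suc n))) c = Valid-B n (suc c)

∣B∣ : ∀ n c → ∣ B n c ∣ ≡ suc (n ℕ.+ c ℕ.* 3)
∣B∣ 0 c = eq c
  where
  eq : ∀ c → suc c ℕ.+ (c ℕ.+ (c ℕ.+ 0)) ≡ suc (0 ℕ.+ c ℕ.* 3)
  eq = solve-∀
∣B∣ 1 c = eq c
  where
  eq : ∀ c → suc c ℕ.+ (suc c ℕ.+ (c ℕ.+ 0)) ≡ suc (1 ℕ.+ c ℕ.* 3)
  eq = solve-∀
∣B∣ 2 c = eq c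
  where
  eq : ∀ c → suc (suc c) ℕ.+ (suc c ℕ.+ (c ℕ.+ 0)) ≡ suc (2 ℕ.+ c ℕ.* 3)
  eq = solve-∀
∣B∣ (suc (suc (suc n))) c = trans (∣B∣ n (suc c)) (eq n c)
  where
  eq : ∀ n c → 1 ℕ.+ (n ℕ.+ (1 ℕ.+ c) ℕ.* 3) ≡ 1 ℕ.+ ((3 ℕ.+ n) ℕ.+ c ℕ.* 3)
  eq = solve-∀

∣A∣ : ∀ n c → ∣ A n c ∣ ≡ suc (suc (n ℕ.+ c ℕ.* 3))
∣A∣ 0 c = eq c
  where
  eq : ∀ c → suc (suc c) ℕ.+ (c ℕ.+ (c ℕ.+ 0)) ≡ suc (suc (0 ℕ.+ c ℕ.* 3))
  eq = solve-∀
∣A∣ 1 c = eq c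
  where
  eq : ∀ c → suc c ℕ.+ (suc c ℕ.+ (suc c ℕ.+ 0)) ≡ suc (suc (1 ℕ.+ c ℕ.* 3))
  eq = solve-∀
∣A∣ 2 c = eq c
  where
  eq : ∀ c → suc (suc c) ℕ.+ (suc (suc c) ℕ.+ (c ℕ.+ 0)) ≡ suc (suc (2 ℕ.+ c ℕ.* 3))
  eq = solve-∀
∣A∣ (suc (suc (suc n))) c = trans (∣A∣ n (suc c)) (eq n c)
  where
  eq : ∀ n c → 2 ℕ.+ (n ℕ.+ (1 ℕ.+ c) ℕ.* 3) ≡ 2 ℕ.+ ((3 ℕ.+ n) ℕ.+ c ℕ.* 3)
  eq = solve-∀

B≼A : ∀ n c → B n c ≼ A n c
B≼A 0 c = ℕₚ.n≤1+n _ , ℕₚ.≤-refl , ℕₚ.≤-refl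
B≼A 1 c = ℕₚ.≤-refl , ℕₚ.≤-refl , ℕₚ.n≤1+n _
B≼A 2 c = ℕₚ.≤-refl , ℕₚ.n≤1+n _ , ℕₚ.≤-refl
B≼A (suc (suc (suc n))) c = B≼A n (suc c)

B≼B : ∀ n c → B n c ≼ B (suc n) c
B≼B 0 c = ℕₚ.≤-refl , ℕₚ.n≤1+n _ , ℕₚ.≤-refl
B≼B 1 c = ℕₚ.n≤1+n _ , ℕₚ.≤-refl , ℕₚ.≤-refl
B≼B 2 c = ℕₚ.≤-refl , ℕₚ.≤-refl , ℕₚ.n≤1+n _
B≼B (suc (suc (suc n))) c = B≼B n (suc c)

A≼B : ∀ n c → A n c ≼ B (suc (suc n)) c
A≼B 0 c = ℕₚ.≤-refl , ℕₚ.n≤1+n _ , ℕₚ.≤-refl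
A≼B 1 c = ℕₚ.n≤1+n _ , ℕₚ.≤-refl , ℕₚ.≤-refl
A≼B 2 c = ℕₚ.≤-refl , ℕₚ.≤-refl , ℕₚ.n≤1+n _
A≼B (suc (suc (suc n))) c = A≼B n (suc c)

-- The two layers have the same size, so `∣∣-mono` cannot tell them apart; in each residue class of
-- n mod 3 one coordinate of `A` exceeds that of `B` by 1.
A⋠B : ∀ n c → ¬ A n c ≼ B (suc n) c
A⋠B 0 c (p , _ , _) = ℕₚ.1+n≰n p
A⋠B 1 c (_ , _ , p) = ℕₚ.1+n≰n p
A⋠B 2 c (_ , p , _) = ℕₚ.1+n≰n p
A⋠B (suc (suc (suc n))) c = A⋠B n (suc c)

≤-suc-split : ∀ {m n} → m ≤ suc n → m ≤ n ⊎ m ≡ suc n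
≤-suc-split m≤1+n = Sum.map₁ ℕₚ.≤-pred (ℕₚ.m≤n⇒m<n∨m≡n m≤1+n)

-- `B n c` arises from `A n c` by lowering one coordinate by 1. If that coordinate of the layer is
-- maximal, validity forces the other two to be maximal as well.
below-A : ∀ n c {l} → Valid l → l ≼ A n c → l ≡ A n c ⊎ l ≼ B n c
below-A 0 c (y≤x , z≤y , x≤2+z) (x≤ , y≤ , z≤) with ≤-suc-split x≤
... | inj₁ x≤1+c = inj₂ (x≤1+c , y≤ , z≤)
... | inj₂ refl  = inj₁ (cong (2 ℕ.+ c ,_) (cong₂ _,_ (ℕₚ.≤-antisym y≤ (ℕₚ.≤-trans c≤z z≤y)) (ℕₚ.≤-antisym z≤ c≤z)))
  where c≤z = ℕₚ.≤-pred (ℕₚ.≤-pred x≤2+z)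
below-A 1 c (y≤x , z≤y , x≤2+z) (x≤ , y≤ , z≤) with ≤-suc-split z≤
... | inj₁ z≤c  = inj₂ (x≤ , y≤ , z≤c)
... | inj₂ refl = inj₁ (cong₂ _,_ (ℕₚ.≤-antisym x≤ (ℕₚ.≤-trans z≤y y≤x)) (cong (_, suc c) (ℕₚ.≤-antisym y≤ z≤y)))
below-A 2 c (y≤x , z≤y , x≤2+z) (x≤ , y≤ , z≤) with ≤-suc-split y≤
... | inj₁ y≤1+c = inj₂ (x≤ , y≤1+c , z≤)
... | inj₂ refl  = inj₁ (cong₂ _,_ (ℕₚ.≤-antisym x≤ y≤x)
  (cong (2 ℕ.+ c ,_) (ℕₚ.≤-antisym z≤ (ℕₚ.≤-pred (ℕₚ.≤-pred (ℕₚ.≤-trans y≤x x≤2+z))))))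
below-A (suc (suc (suc n))) c = below-A n (suc c)

below-B₀ : ∀ {l} → Valid l → l ≼ B 0 0 → l ≡ B 0 0 ⊎ l ≼ (0 , 0 , 0)
below-B₀ {zero , zero , zero} _ _ = inj₂ ≼-refl
below-B₀ {suc zero , zero , zero} _ _ = inj₁ refl
below-B₀ {suc (suc _) , zero , zero} _ (s≤s () , _ , _)

below-B₁ : ∀ {l} → Valid l → l ≼ B 1 0 → l ≡ B 1 0 ⊎ l ≼ B 0 0
below-B₁ (y≤x , _ , _) (x≤ , y≤ , z≤n) with ≤-suc-split y≤
... | inj₁ y≤0  = inj₂ (x≤ , y≤0 , z≤n)
... | inj₂ refl = inj₁ (cong (_, 1 , 0) (ℕₚ.≤-antisym x≤ y≤x))

-- `B (1 + n) c` and `A n c` each lower one coordinate of `B (2 + n) c` by 1, and not the same one.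
-- If both of these coordinates are maximal, validity fixes the third.
below-B₂ : ∀ n c {l} → Valid l → l ≼ B (2 ℕ.+ n) c → l ≡ B (2 ℕ.+ n) c ⊎ l ≼ B (1 ℕ.+ n) c ⊎ l ≼ A n c
below-B₂ 0 c (y≤x , z≤y , x≤2+z) (x≤ , y≤ , z≤) with ≤-suc-split x≤ | ≤-suc-split y≤
... | inj₁ x≤1+c | _         = inj₂ (inj₁ (x≤1+c , y≤ , z≤))
... | inj₂ refl  | inj₁ y≤c  = inj₂ (inj₂ (x≤ , y≤c , z≤))
... | inj₂ refl  | inj₂ refl = inj₁ (cong (λ z → 2 ℕ.+ c , 1 ℕ.+ c , z) (ℕₚ.≤-antisym z≤ (ℕₚ.≤-pred (ℕₚ.≤-pred x≤2+z))))
below-B₂ 1 c (y≤x , z≤y , x≤2+z) (x≤ , y≤ , z≤) with ≤-suc-split x≤ | ≤-suc-split z≤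
... | inj₁ x≤1+c | _         = inj₂ (inj₂ (x≤1+c , y≤ , z≤))
... | inj₂ refl  | inj₁ z≤c  = inj₂ (inj₁ (x≤ , y≤ , z≤c))
... | inj₂ refl  | inj₂ refl = inj₁ (cong (λ y → 2 ℕ.+ c , y , 1 ℕ.+ c) (ℕₚ.≤-antisym y≤ z≤y))
below-B₂ 2 c (y≤x , z≤y , x≤2+z) (x≤ , y≤ , z≤) with ≤-suc-split y≤ | ≤-suc-split z≤
... | inj₁ y≤1+c | _         = inj₂ (inj₁ (x≤ , y≤1+c , z≤))
... | inj₂ refl  | inj₁ z≤c  = inj₂ (inj₂ (x≤ , y≤ , z≤c))
... | inj₂ refl  | inj₂ refl = inj₁ (cong (_, 2 ℕ.+ c , 1 ℕ.+ c) (ℕₚ.≤-antisym x≤ y≤x))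
below-B₂ (suc (suc (suc n))) c = below-B₂ n (suc c)

-- The index 6k+1 is adapted to two needs: raising k by 1 unfolds the recursion of `B` exactly
-- twice, and the index is odd, as in the D_{2i+1} of `E≈D`.
B-large : ∀ k c → (k ℕ.+ c , k ℕ.+ c , k ℕ.+ c) ≼ B (suc (k ℕ.* 3 ℕ.* 2)) c
B-large zero    c = ℕₚ.n≤1+n c , ℕₚ.n≤1+n c , ℕₚ.≤-refl
B-large (suc k) c = ≼-trans (step , step , step) (B-large k (suc (suc c)))
  where
  step : suc k ℕ.+ c ≤ k ℕ.+ suc (suc c)
  step = ℕₚ.≤-trans (ℕₚ.≤-reflexive (sym (ℕₚ.+-suc k c))) (ℕₚ.+-monoʳ-≤ k (ℕₚ.n≤1+n (suc c)))

-- Adding and removing the bottom layer of a cylindric partition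

Tuple : Set
Tuple = Vec (List ℕ) 3

Cylindric : Tuple → Set
Cylindric = IsCylindricPartition (2 ∷ 0 ∷ 0 ∷ [])

lengths : Tuple → Layer
lengths (x ∷ y ∷ z ∷ []) = length x , length y , length z

growAll : Layer → Tuple → Tuple
growAll (a , b , c) (x ∷ y ∷ z ∷ []) = grow a x ∷ grow b y ∷ grow c z ∷ []

stripAll : Tuple → Tuple
stripAll (x ∷ y ∷ z ∷ []) = strip x ∷ strip y ∷ strip z ∷ []

cylindric : ∀ {x y z} → IsPartition x → IsPartition y → IsPartition z →
  Dominates 0 x y → Dominates 0 y z → Dominates 2 z x → Cylindric (x ∷ y ∷ z ∷ [])
cylindric px py pz xy yz zx =
  (λ { zero → px ; (suc zero) → py ; (suc (suc zero)) → pz }) ,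
  (λ { zero → xy ; (suc zero) → yz ; (suc (suc zero)) → zx })

Valid-lengths : ∀ Λ → Cylindric Λ → Valid (lengths Λ)
Valid-lengths (x ∷ y ∷ z ∷ []) (parts , dom) =
  Dominates-length 0 x (proj₂ (parts (suc zero))) (dom zero) ,
  Dominates-length 0 y (proj₂ (parts (suc (suc zero)))) (dom (suc zero)) ,
  Dominates-length 2 z (proj₂ (parts zero)) (dom (suc (suc zero)))

Cylindric-grow : ∀ {l} Λ → Valid l → Cylindric Λ → Cylindric (growAll l Λ)
Cylindric-grow (x ∷ y ∷ z ∷ []) (b≤a , c≤b , a≤2+c) (parts , dom) = cylindric
  (IsPartition-grow _ (parts zero)) (IsPartition-grow _ (parts (suc zero))) (IsPartition-grow _ (parts (suc (suc zero))))
  (Dominates-grow 0 x y b≤a (dom zero)) (Dominates-grow 0 y z c≤b (dom (suc zero)))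
  (Dominates-grow 2 z x a≤2+c (dom (suc (suc zero))))

Cylindric-strip : ∀ Λ → Cylindric Λ → Cylindric (stripAll Λ)
Cylindric-strip (x ∷ y ∷ z ∷ []) (parts , dom) = cylindric
  (IsPartition-strip px) (IsPartition-strip py) (IsPartition-strip pz)
  (Dominates-strip 0 (proj₁ px) (proj₁ py) (dom zero)) (Dominates-strip 0 (proj₁ py) (proj₁ pz) (dom (suc zero)))
  (Dominates-strip 2 (proj₁ pz) (proj₁ px) (dom (suc (suc zero))))
  where
  px = parts zero
  py = parts (suc zero)
  pz = parts (suc (suc zero))

lengths-grow : ∀ l Λ → lengths (growAll l Λ) ≡ l
lengths-grow (a , b , c) (x ∷ y ∷ z ∷ []) =
  cong₂ _,_ (length-grow a x) (cong₂ _,_ (length-grow b y) (length-grow c z))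

lengths-strip : ∀ Λ → lengths (stripAll Λ) ≼ lengths Λ
lengths-strip (x ∷ y ∷ z ∷ []) = length-strip x , length-strip y , length-strip z

cpSize-grow : ∀ {l} Λ → lengths Λ ≼ l → cpSize (growAll l Λ) ≡ ∣ l ∣ ℕ.+ cpSize Λ
cpSize-grow {a , b , c} (x ∷ y ∷ z ∷ []) (x≤ , y≤ , z≤) = trans
  (cong₂ ℕ._+_ (sum-grow x x≤) (cong₂ ℕ._+_ (sum-grow y y≤) (cong (ℕ._+ 0) (sum-grow z z≤))))
  (regroup a b c (sum x) (sum y) (sum z))
  where
  regroup : ∀ a b c x y z → a ℕ.+ x ℕ.+ (b ℕ.+ y ℕ.+ (c ℕ.+ z ℕ.+ 0)) ≡
                            a ℕ.+ (b ℕ.+ (c ℕ.+ 0)) ℕ.+ (x ℕ.+ (y ℕ.+ (z ℕ.+ 0)))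
  regroup = solve-∀

stripAll-growAll : ∀ {l} Λ → Cylindric Λ → lengths Λ ≼ l → stripAll (growAll l Λ) ≡ Λ
stripAll-growAll (x ∷ y ∷ z ∷ []) (parts , _) (x≤ , y≤ , z≤) = cong₂ _∷_ (strip-grow (proj₂ (parts zero)) x≤)
  (cong₂ _∷_ (strip-grow (proj₂ (parts (suc zero))) y≤)
    (cong (_∷ []) (strip-grow (proj₂ (parts (suc (suc zero)))) z≤)))

growAll-stripAll : ∀ Λ → Cylindric Λ → growAll (lengths Λ) (stripAll Λ) ≡ Λ
growAll-stripAll (x ∷ y ∷ z ∷ []) (parts , _) = cong₂ _∷_ (grow-strip (proj₁ px) (proj₂ px))
  (cong₂ _∷_ (grow-strip (proj₁ py) (proj₂ py)) (cong (_∷ []) (grow-strip (proj₁ pz) (proj₂ pz))))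
  where
  px = parts zero
  py = parts (suc zero)
  pz = parts (suc (suc zero))

-- Counting cylindric partitions by their bottom layer

record Below (l : Layer) (N : ℕ) (Λ : Tuple) : Set where
  constructor below
  field
    cylindric-Λ : Cylindric Λ
    lengths-Λ   : lengths Λ ≼ l
    size-Λ      : cpSize Λ ≡ N

record Exactly (l : Layer) (N : ℕ) (Λ : Tuple) : Set where
  constructor exactly
  field
    cylindric-Λ : Cylindric Λ
    lengths-Λ   : lengths Λ ≡ l
    size-Λ      : cpSize Λ ≡ N

-- Removing the bottom layer `l` leaves any cylindric partition whose own bottom layer fits in `l`.
-- This bijection is the source of the factor q^{∣l∣} in the recurrences.
HasCount-Exactly : ∀ {l N k} → Valid l → HasCount (Below l N) k → HasCount (Exactly l (∣ l ∣ ℕ.+ N)) k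
HasCount-Exactly {l} {N} valid = HasCount-bijection (growAll l) stripAll
  (λ { Λ (below cyl len size) → exactly
       (Cylindric-grow Λ valid cyl) (lengths-grow l Λ) (trans (cpSize-grow Λ len) (cong (∣ l ∣ ℕ.+_) size)) })
  (λ { Λ (exactly cyl refl size) → below
       (Cylindric-strip Λ cyl) (lengths-strip Λ)
       (ℕₚ.+-cancelˡ-≡ ∣ l ∣ _ _ (trans (sym (cpSize-grow (stripAll Λ) (lengths-strip Λ)))
         (trans (cong cpSize (growAll-stripAll Λ cyl)) size))) })
  (λ { Λ (below cyl len _) → stripAll-growAll Λ cyl len })
  (λ { Λ (exactly cyl refl _) → growAll-stripAll Λ cyl })

Exactly-size : ∀ {l N} Λ → Exactly l N Λ → ∣ l ∣ ≤ N
Exactly-size (x ∷ y ∷ z ∷ []) (exactly (parts , _) refl refl) = ℕₚ.+-mono-≤ (length≤sum (proj₂ (parts zero)))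
  (ℕₚ.+-mono-≤ (length≤sum (proj₂ (parts (suc zero)))) (ℕₚ.+-monoˡ-≤ 0 (length≤sum (proj₂ (parts (suc (suc zero)))))))

Counted : (ℕ → Tuple → Set) → Series → Set
Counted P f = ∀ N → Σ ℕ λ k → HasCount (P N) k × + k ≡ f N

Counted-⊎ : ∀ {P Q f g} → (∀ N Λ → P N Λ → ¬ Q N Λ) → Counted P f → Counted Q g →
  Counted (λ N Λ → P N Λ ⊎ Q N Λ) (f +ₛ g)
Counted-⊎ disjoint countP countQ N =
  let k , hasK , k≡ = countP N
      l , hasL , l≡ = countQ N
  in k ℕ.+ l , HasCount-⊎ (disjoint N) hasK hasL , cong₂ ℤ._+_ k≡ l≡

-- Only the count at the size N - ∣l∣ is asked for, so that the lemma also applies inside a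
-- recursion on N, where `f` is known to count only at smaller sizes.
Exactly-at : ∀ {l} f → Valid l → ∀ N →
  (∀ {M} → ∣ l ∣ ℕ.+ M ≡ N → Σ ℕ λ k → HasCount (Below l M) k × + k ≡ f M) →
  Σ ℕ λ k → HasCount (Exactly l N) k × + k ≡ (qpow ∣ l ∣ *ₛ f) N
Exactly-at {l} f valid N counted with ∣ l ∣ ℕ.≤? N
... | no  l≰N = 0 , HasCount-empty (λ Λ ex → l≰N (Exactly-size Λ ex)) , sym (qpow-*-< ∣ l ∣ f N (ℕₚ.≰⇒> l≰N))
... | yes l≤N with ℕₚ.m≤n⇒∃[o]m+o≡n l≤N
...   | M , refl = let k , count , k≡ = counted refl in
  k , HasCount-Exactly valid count , trans k≡ (sym (qpow-*-+ ∣ l ∣ f M))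

Counted-Exactly : ∀ {l f} → Valid l → Counted (Below l) f → Counted (Exactly l) (qpow ∣ l ∣ *ₛ f)
Counted-Exactly {f = f} valid counted N = Exactly-at f valid N (λ {M} _ → counted M)

-- The equation f = g + q^{s+1} f is used without dividing: the partitions with bottom layer exactly
-- `l` reduce to strictly smaller sizes because `l` is nonempty, so strong induction on N applies.
Counted-Below : ∀ {l s P f g} → ∣ l ∣ ≡ suc s → Valid l →
  (∀ N Λ → Below l N Λ ⇔ (P N Λ ⊎ Exactly l N Λ)) → (∀ N Λ → P N Λ → ¬ Exactly l N Λ) →
  Counted P g → (∀ N → f N ≡ g N ℤ.+ (qpow (suc s) *ₛ f) N) → Counted (Below l) f
Counted-Below {l} {s} {f = f} {g} size valid split disjoint counted f≡ = <-rec _ λ N rec →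
  let k , hasK , k≡ = counted N
      m , hasM , m≡ = Exactly-at f valid N
        (λ {M} l+M≡N → rec (ℕₚ.≤-trans (s≤s (ℕₚ.m≤n+m M s))
          (ℕₚ.≤-reflexive (trans (cong (ℕ._+ M) (sym size)) l+M≡N))))
      open Equivalence
  in k ℕ.+ m ,
     HasCount-⇔ (λ Λ → mk⇔ (from (split N Λ)) (to (split N Λ))) (HasCount-⊎ (disjoint N) hasK hasM) ,
     trans (cong₂ ℤ._+_ k≡ m≡) (trans (cong (λ s′ → g N ℤ.+ (qpow s′ *ₛ f) N) size) (sym (f≡ N)))

Below-mono : ∀ {l m N Λ} → l ≼ m → Below l N Λ → Below m N Λ
Below-mono l≼m (below cyl len size) = below cyl (≼-trans len l≼m) size

Exactly⇒Below : ∀ {l m N Λ} → l ≼ m → Exactly l N Λ → Below m N Λ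
Exactly⇒Below l≼m (exactly cyl refl size) = below cyl l≼m size

Below-disjoint : ∀ {l m N Λ} → ∣ l ∣ < ∣ m ∣ → Below l N Λ → ¬ Exactly m N Λ
Below-disjoint l<m (below _ len _) (exactly _ refl _) = ℕₚ.<⇒≱ l<m (∣∣-mono len)

Counted-empty : Counted (Below (0 , 0 , 0)) oneₛ
Counted-empty zero    = 1 , HasCount-singleton ∅ (below ∅-cylindric ≼-refl refl) only , refl
  where
  ∅ : Tuple
  ∅ = [] ∷ [] ∷ [] ∷ []
  p : IsPartition []
  p = [] , []
  ∅-cylindric : Cylindric ∅
  ∅-cylindric = cylindric p p p (λ _ → z≤n) (λ _ → z≤n) (λ _ → z≤n)
  only : ∀ Λ → Below (0 , 0 , 0) 0 Λ → Λ ≡ ∅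
  only ([] ∷ [] ∷ [] ∷ []) _ = refl
Counted-empty (suc N) = 0 , HasCount-empty none , refl
  where
  none : ∀ Λ → ¬ Below (0 , 0 , 0) (suc N) Λ
  none ([] ∷ [] ∷ [] ∷ []) (below _ _ ())

<-A : ∀ n → ∣ B n 0 ∣ < ∣ A n 0 ∣
<-A n = ℕₚ.≤-reflexive (trans (cong suc (∣B∣ n 0)) (sym (∣A∣ n 0)))

<-B : ∀ n → ∣ B n 0 ∣ < ∣ B (suc n) 0 ∣
<-B n = ℕₚ.≤-reflexive (trans (cong suc (∣B∣ n 0)) (sym (∣B∣ (suc n) 0)))

Below-split : ∀ {l m} → m ≼ l → (∀ {t} → Valid t → t ≼ l → t ≡ l ⊎ t ≼ m) →
  ∀ N Λ → Below l N Λ ⇔ (Below m N Λ ⊎ Exactly l N Λ)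
Below-split {l} {m} m≼l split N Λ = mk⇔ to [ Below-mono m≼l , Exactly⇒Below ≼-refl ]
  where
  to : Below l N Λ → Below m N Λ ⊎ Exactly l N Λ
  to (below cyl len size) with split (Valid-lengths Λ cyl) len
  ... | inj₁ eq = inj₂ (exactly cyl eq size)
  ... | inj₂ lt = inj₁ (below cyl lt size)

Below-B₂ : ∀ n N Λ → Below (B (2 ℕ.+ n) 0) N Λ ⇔
  ((Below (B (1 ℕ.+ n) 0) N Λ ⊎ Exactly (A n 0) N Λ) ⊎ Exactly (B (2 ℕ.+ n) 0) N Λ)
Below-B₂ n N Λ = mk⇔ to [ [ Below-mono (B≼B (suc n) 0) , Exactly⇒Below (A≼B n 0) ] , Exactly⇒Below ≼-refl ]
  where
  to : Below (B (2 ℕ.+ n) 0) N Λ → (Below (B (1 ℕ.+ n) 0) N Λ ⊎ Exactly (A n 0) N Λ) ⊎ Exactly (B (2 ℕ.+ n) 0) N Λ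
  to (below cyl len size) with below-B₂ n 0 (Valid-lengths Λ cyl) len
  ... | inj₁ eq        = inj₂ (exactly cyl eq size)
  ... | inj₂ (inj₁ lt) = inj₁ (inj₁ (below cyl lt size))
  -- Layers below `A n 0` other than `A n 0` itself already lie below `B (1 + n) 0`. Splitting them
  -- off here keeps the union disjoint.
  ... | inj₂ (inj₂ le) with below-A n 0 (Valid-lengths Λ cyl) le
  ...   | inj₁ eq = inj₁ (inj₂ (exactly cyl eq size))
  ...   | inj₂ lt = inj₁ (inj₁ (below cyl (≼-trans lt (B≼B n 0)) size))

A-not-below-B : ∀ n N Λ → Below (B (suc n) 0) N Λ → ¬ Exactly (A n 0) N Λ
A-not-below-B n N Λ (below _ len _) (exactly _ eq _) = A⋠B n 0 (subst (_≼ B (suc n) 0) eq len)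

module _ (a b : ℕ → Series)
  (a-eq : ∀ n N → a n N ≡ b n N ℤ.+ (qpow (2 ℕ.+ n) *ₛ a n) N)
  (b-0 : ∀ N → b 0 N ≡ oneₛ N ℤ.+ (qpow 1 *ₛ b 0) N)
  (b-1 : ∀ N → b 1 N ≡ b 0 N ℤ.+ (qpow 2 *ₛ b 1) N)
  (b-eq : ∀ n N → b (2 ℕ.+ n) N ≡ (b (1 ℕ.+ n) +ₛ qpow (2 ℕ.+ n) *ₛ a n) N ℤ.+ (qpow (3 ℕ.+ n) *ₛ b (2 ℕ.+ n)) N)
  where

  ∣A₀∣ : ∀ n → ∣ A n 0 ∣ ≡ 2 ℕ.+ n
  ∣A₀∣ n = trans (∣A∣ n 0) (cong (λ m → 2 ℕ.+ m) (ℕₚ.+-identityʳ n))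

  ∣B₀∣ : ∀ n → ∣ B n 0 ∣ ≡ 1 ℕ.+ n
  ∣B₀∣ n = trans (∣B∣ n 0) (cong suc (ℕₚ.+-identityʳ n))

  Counted-A : ∀ n → Counted (Below (B n 0)) (b n) → Counted (Below (A n 0)) (a n)
  Counted-A n counted = Counted-Below (∣A₀∣ n) (Valid-A n 0) (Below-split (B≼A n 0) (below-A n 0))
    (λ N Λ → Below-disjoint (<-A n)) counted (a-eq n)

  Counted-B : ∀ n → Counted (Below (B n 0)) (b n)
  Counted-B 0 = Counted-Below refl (Valid-B 0 0) (Below-split (z≤n , z≤n , z≤n) below-B₀)
    (λ N Λ → Below-disjoint (s≤s z≤n)) Counted-empty b-0
  Counted-B 1 = Counted-Below refl (Valid-B 1 0) (Below-split (B≼B 0 0) below-B₁)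
    (λ N Λ → Below-disjoint (<-B 0)) (Counted-B 0) b-1
  Counted-B (suc (suc n)) = Counted-Below (∣B₀∣ (2 ℕ.+ n)) (Valid-B (2 ℕ.+ n) 0) (Below-B₂ n)
    (λ N Λ → [ Below-disjoint (<-B (suc n)) , (λ ex → Below-disjoint (A<B n) (Exactly⇒Below ≼-refl ex)) ])
    (Counted-⊎ (A-not-below-B n) (Counted-B (suc n))
      (subst (λ s → Counted (Exactly (A n 0)) (qpow s *ₛ a n)) (∣A₀∣ n)
        (Counted-Exactly (Valid-A n 0) (Counted-A n (Counted-B n)))))
    (b-eq n)
    where
    A<B : ∀ n → ∣ A n 0 ∣ < ∣ B (2 ℕ.+ n) 0 ∣
    A<B n = ℕₚ.≤-reflexive (trans (cong suc (∣A₀∣ n)) (sym (∣B₀∣ (2 ℕ.+ n))))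

-- Parts are positive, so a component of a partition of size N has at most N parts; the layer (N, N,
-- N) lies below this `B`, whose bound is therefore no restriction.
Below-large : ∀ N Λ → Below (B (suc (N ℕ.* 3 ℕ.* 2)) 0) N Λ ⇔ (Cylindric Λ × cpSize Λ ≡ N)
Below-large N Λ = mk⇔ (λ { (below cyl _ size) → cyl , size }) (λ { (cyl , size) → below cyl (len Λ cyl size) size })
  where
  len : ∀ Λ → Cylindric Λ → cpSize Λ ≡ N → lengths Λ ≼ B (suc (N ℕ.* 3 ℕ.* 2)) 0
  len (x ∷ y ∷ z ∷ []) (parts , _) refl = ≼-trans
    ( ℕₚ.m≤n⇒m≤n+o 0 (ℕₚ.m≤n⇒m≤n+o (sum y ℕ.+ (sum z ℕ.+ 0)) (length≤sum (proj₂ (parts zero))))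
    , ℕₚ.m≤n⇒m≤n+o 0 (ℕₚ.m≤n⇒m≤o+n (sum x)
        (ℕₚ.m≤n⇒m≤n+o (sum z ℕ.+ 0) (length≤sum (proj₂ (parts (suc zero))))))
    , ℕₚ.m≤n⇒m≤n+o 0 (ℕₚ.m≤n⇒m≤o+n (sum x) (ℕₚ.m≤n⇒m≤o+n (sum y)
        (ℕₚ.m≤n⇒m≤n+o 0 (length≤sum (proj₂ (parts (suc (suc zero)))))))))
    (B-large N 0)

-- Generating functions

factor : ℕ → Series
factor n = oneₛ -ₛ qpow (suc n)

-- These are a_{n+2} and b_{n+1} of the header. The denominators match the layer sizes: `factor n`
-- is 1 - q^{n+1} with n+1 the size of `B n 0`, and `A n 0` is larger by 1.
a b : ℕ → Series
a n             = b n *ₛ invₛ (factor (suc n))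
b 0             = oneₛ *ₛ invₛ (factor 0)
b 1             = b 0 *ₛ invₛ (factor 1)
b (suc (suc n)) = (b (suc n) +ₛ qpow (2 ℕ.+ n) *ₛ a n) *ₛ invₛ (factor (2 ℕ.+ n))

pochFactor : Series → Series → ℕ → Series
pochFactor x p k = oneₛ -ₛ x *ₛ (p ^ₛ k)

finProd-constant : ∀ F → (∀ k → F k 0 ≡ + 1) → ∀ n → finProd n F 0 ≡ + 1
finProd-constant F F≡1 zero    = refl
finProd-constant F F≡1 (suc n) =
  trans (ℤₚ.+-identityˡ _) (cong₂ ℤ._*_ (finProd-constant F F≡1 n) (F≡1 n))

module _ (N : ℕ) where
  open Truncated N
  open RingIdentities (truncatedRing N) using (*-quotient; quotient-recurrence; 1-neg; solve-for)

  factor*quotient : ∀ g n → factor n * (g * invₛ (factor n)) ≈ g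
  factor*quotient g n = *-quotient {factor n} {invₛ (factor n)} (*-inverseʳ (factor n) refl) g

  quotient-unfold : ∀ g n → g * invₛ (factor n) ≈ g + qpow (suc n) * (g * invₛ (factor n))
  quotient-unfold g n = quotient-recurrence {qpow (suc n)} {g * invₛ (factor n)} {g} (factor*quotient g n)

  pochFactor-qpow : ∀ m k → pochFactor (qpow m) (qpow m) k ≈ 1# + - qpow (suc k ℕ.* m)
  pochFactor-qpow m k n n≤N = cong (λ x → oneₛ n ℤ.- x) (qpow-^ m k n n≤N)

  pochFactor-neg : ∀ m k → pochFactor (negₛ (qpow m)) (qpow m) k ≈ 1# + qpow (suc k ℕ.* m)
  pochFactor-neg m k = 1-neg {qpow m} {qpow m ^ₛ k} {qpow (suc k ℕ.* m)} (qpow-^ m k)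

  qpow-homomorphic : ∀ m n → qpow m * qpow n ≈ qpow (m ℕ.+ n)
  qpow-homomorphic m n k _ = qpow-+ m n k

  qpow-vanish : ∀ {n} → N < n → qpow n ≈ 0#
  qpow-vanish {n} N<n k k≤N = qpow-< n k (ℕₚ.≤-<-trans k≤N N<n)

  open RingIdentities.RogersRamanujan (truncatedRing N) qpow ≈-refl qpow-homomorphic N qpow-vanish public

qpow-multiple-< : ∀ m {n k} → n ≤ k → qpow (suc k ℕ.* suc m) n ≡ + 0
qpow-multiple-< m {n} {k} n≤k = qpow-< (suc k ℕ.* suc m) n (ℕₚ.≤-trans (s≤s n≤k) (ℕₚ.m≤m*n (suc k) (suc m)))

pochFactor-qpow-1 : ∀ m k n → n ≤ k → pochFactor (qpow (suc m)) (qpow (suc m)) k n ≡ oneₛ n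
pochFactor-qpow-1 m k n n≤k = trans (pochFactor-qpow n (suc m) k n ℕₚ.≤-refl)
  (trans (cong (λ x → oneₛ n ℤ.- x) (qpow-multiple-< m n≤k)) (ℤₚ.+-identityʳ _))

pochFactor-neg-1 : ∀ m k n → n ≤ k → pochFactor (negₛ (qpow (suc m))) (qpow (suc m)) k n ≡ oneₛ n
pochFactor-neg-1 m k n n≤k = trans (pochFactor-neg n (suc m) k n ℕₚ.≤-refl)
  (trans (cong (λ x → oneₛ n ℤ.+ x) (qpow-multiple-< m n≤k)) (ℤₚ.+-identityʳ _))

-- Comparison of the right-hand side with the generating function, up to degree N

W P₁ P₄ I₄ : ℕ → Series
W n  = finProd n (pochFactor (negₛ (qpow 2)) (qpow 2))
P₁ n = finProd n (pochFactor (qpow 1) (qpow 1))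
P₄   = poch (qpow 4) (qpow 4)
I₄ n = invₛ (P₄ n)

slaterTerm : ℕ → Series
slaterTerm n = qpow (n ℕ.* n ℕ.+ 2 ℕ.* n) *ₛ I₄ n

slaterTerm-< : ∀ k n → n < k → slaterTerm k n ≡ + 0
slaterTerm-< k n n<k = qpow-*-< (k ℕ.* k ℕ.+ 2 ℕ.* k) (I₄ k) n
  (ℕₚ.≤-trans n<k (ℕₚ.m≤n⇒m≤o+n (k ℕ.* k) (ℕₚ.m≤n*m k 2)))

module _ (N : ℕ) where
  open Truncated N
  open RingIdentities (truncatedRing N) using (*-quotient; quotient-recurrence; 1-neg; solve-for)

  sumₛ-slaterTerm : ∀ n → sumₛ n slaterTerm ≈ slaterSum N I₄ n
  sumₛ-slaterTerm zero    m m≤N = refl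
  sumₛ-slaterTerm (suc n) m m≤N = cong (λ x → x ℤ.+ slaterTerm n m) (sumₛ-slaterTerm n m m≤N)

  W*slaterSum : W (suc N) * slaterSum N I₄ (suc N) ≈ D N (suc (N ℕ.* 3 ℕ.* 2))
  W*slaterSum = Slater.W*slaterSum≈D N W P₄ I₄
    (λ _ _ → refl)
    (λ n → *-congˡ {W n} (pochFactor-neg N 2 n))
    (λ _ _ → refl)
    (λ n → *-congˡ {P₄ n} (pochFactor-qpow N 4 n))
    (λ n → *-inverseʳ (P₄ n) (finProd-constant _ (λ _ → refl) n))
    -- The choice i = 3N gives D_{6N+1}, matching the layer in `Below-large`.
    (N ℕ.* 3) (ℕₚ.m≤m*n N 3)

  P₁*b : ∀ n → P₁ (suc n) * b n ≈ D N n
  P₁*b = Counting.P*b≈D N a b P₁ factor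
    (λ _ _ → refl)
    (λ n → *-congˡ {P₁ n} (λ k k≤N → trans (pochFactor-qpow N 1 n k k≤N)
      (cong (λ m → oneₛ k ℤ.- qpow m k) (ℕₚ.*-identityʳ (suc n)))))
    (λ n → factor*quotient N (b n) (suc n))
    (factor*quotient N oneₛ 0)
    (factor*quotient N (b 0) 1)
    (λ n → factor*quotient N (b (suc n) +ₛ qpow (2 ℕ.+ n) *ₛ a n) (2 ℕ.+ n))

  rhs≈b : rhs ≈ b (suc (N ℕ.* 3 ℕ.* 2))
  rhs≈b = solve-for
    {s = slaterSum N I₄ (suc N)} {infSum slaterTerm} {W (suc N)} {pochInf (negₛ (qpow 2)) (qpow 2)}
    {P₁ (suc M)} {pochInf (qpow 1) (qpow 1)} {invₛ (pochInf (qpow 1) (qpow 1))} {b M} {D N M}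
    (≈-trans {infSum slaterTerm} {sumₛ (suc N) slaterTerm} {slaterSum N I₄ (suc N)}
      (infSum-truncate slaterTerm slaterTerm-<) (sumₛ-slaterTerm (suc N)))
    (infProd-truncate (pochFactor-neg-1 1) {m = suc N} ℕₚ.≤-refl)
    -- M+1 factors are kept because this many clear the denominators of `b M`; those beyond degree N
    -- do not affect the truncation.
    (infProd-truncate (pochFactor-qpow-1 0) {m = suc M} N<1+M)
    (*-inverseʳ (pochInf (qpow 1) (qpow 1)) refl)
    W*slaterSum
    (P₁*b M)
    where
    M = suc (N ℕ.* 3 ℕ.* 2)
    N<1+M : N < suc M
    N<1+M = s≤s (ℕₚ.m≤n⇒m≤1+n (ℕₚ.≤-trans (ℕₚ.m≤m*n N 3) (ℕₚ.m≤m*n (N ℕ.* 3) 2)))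

Counted-b : ∀ n → Counted (Below (B n 0)) (b n)
Counted-b = Counted-B a b
  (λ n N → quotient-unfold N (b n) (suc n) N ℕₚ.≤-refl)
  (λ N → quotient-unfold N oneₛ 0 N ℕₚ.≤-refl)
  (λ N → quotient-unfold N (b 0) 1 N ℕₚ.≤-refl)
  (λ n N → quotient-unfold N (b (suc n) +ₛ qpow (2 ℕ.+ n) *ₛ a n) (2 ℕ.+ n) N ℕₚ.≤-refl)

theorem4p3 : (N : ℕ) → Σ ℕ λ k →
    HasCount (λ (Λ : Vec (List ℕ) 3) → IsCylindricPartition (2 ∷ 0 ∷ 0 ∷ []) Λ × cpSize Λ ≡ N) k
    × + k ≡ rhs N
theorem4p3 N =
  let k , count , k≡b = Counted-b (suc (N ℕ.* 3 ℕ.* 2)) N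
  in k , HasCount-⇔ (Below-large N) count , trans k≡b (sym (rhs≈b N N ℕₚ.≤-refl))
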